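{- Let $M$ be a simple 2-connected planar map such that both $M$ and its dual $M^*$ are weakly outerplanar. Then $\dim(\mathbf{P}_{VF}(M)) \le 3$.
   Context: A planar map $M=(G,D)$ consists of a finite planar multigraph $G$ with a plane drawing $D$, determining vertices, edges, faces and incidences. The vertex-face poset $\mathbf{P}_{VF}(M)$ is the poset on vertices and faces of $M$, with a vertex below a face if it lies on the boundary of that face. The dimension of a poset is the minimum number of linear orders whose intersection is the order. The dual map $M^*$ has a vertex $F^*$ for each face $F$ of $M$ and an edge $e^*$ for each edge $e$ of $M$ joining the dual vertices of the faces separated by $e$. A map is weakly outerplanar if its underlying graph is outerplanar. -}

module Defs where

open import Data.Nat using (ℕ; zero; suc; _+_; _*_; _≤_)
open import Data.Fin using (Fin)
open import Data.Fin.Permutation using (Permutation′; _⟨$⟩ʳ_)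
open import Data.Sum using (_⊎_; inj₁; inj₂)
open import Data.Product using (Σ; ∃; ∃-syntax; _×_; _,_)
open import Data.Empty using (⊥)
open import Data.Unit using (⊤)
open import Relation.Binary.PropositionalEquality using (_≡_; _≢_)
open import Function.Definitions using (Injective)

iter : {A : Set} → (A → A) → ℕ → A → A
iter f zero    x = x
iter f (suc k) x = f (iter f k x)

SameOrbit : {A : Set} → (A → A) → A → A → Set
SameOrbit f x y = ∃[ k ] iter f k x ≡ y

-- `lab : Fin nD → Fin m` labels the orbits of `f` : it is surjective and
-- two darts get the same label iff they lie in the same f-orbit.
-- (So Fin m is the set of orbits of f, up to renaming.)
record OrbitLabelling {nD : ℕ} (f : Fin nD → Fin nD) (m : ℕ)
                      (lab : Fin nD → Fin m) : Set where
  field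
    surj     : ∀ j → ∃[ d ] lab d ≡ j
    sameLab⇒ : ∀ d d' → lab d ≡ lab d' → SameOrbit f d d'
    ⇒sameLab : ∀ d d' → SameOrbit f d d' → lab d ≡ lab d'

-- Underlying multigraph of a map, given by darts (half-edges):
-- edge involution α on darts, and a vertex labelling `lab` of darts.
-- Vertices are Fin n; the dart d is an edge-end at vertex lab d,
-- the edge {d , α d} joins lab d and lab (α d).

data Walk {nD n : ℕ} (α : Fin nD → Fin nD) (lab : Fin nD → Fin n)
          (ok : Fin n → Set) : Fin n → Fin n → Set where
  here : ∀ {u} → ok u → Walk α lab ok u u
  step : ∀ {u w} (d : Fin nD) → lab d ≡ u → ok u →
         Walk α lab ok (lab (α d)) w → Walk α lab ok u w

GConnected : {nD n : ℕ} → (Fin nD → Fin nD) → (Fin nD → Fin n) → Set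
GConnected {n = n} α lab = (u v : Fin n) → Walk α lab (λ _ → ⊤) u v

G2Connected : {nD n : ℕ} → (Fin nD → Fin nD) → (Fin nD → Fin n) → Set
G2Connected {n = n} α lab =
  3 ≤ n × GConnected α lab ×
  ((x u v : Fin n) → u ≢ x → v ≢ x → Walk α lab (λ w → w ≢ x) u v)

GSimple : {nD n : ℕ} → (Fin nD → Fin nD) → (Fin nD → Fin n) → Set
GSimple {nD} α lab =
  ((d : Fin nD) → lab (α d) ≢ lab d) ×
  ((d d' : Fin nD) → lab d ≡ lab d' → lab (α d) ≡ lab (α d') → d ≡ d')

-- Combinatorial maps.  A map on nD darts is a rotation σ (permutation
-- of darts; its orbits are the vertices) and a fixed-point-free
-- involution α (its orbits are the edges).  Faces are the orbits of
-- φ = σ ∘ α.  Vertex set Fin nV, face set Fin nF, with labellings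
-- realising the orbits.

record Map : Set where
  field
    nD     : ℕ
    σ      : Permutation′ nD
    α      : Fin nD → Fin nD
    α-invol : ∀ d → α (α d) ≡ d
    α-free  : ∀ d → α d ≢ d
    nV     : ℕ
    vtx    : Fin nD → Fin nV
    vtx-orbits : OrbitLabelling (σ ⟨$⟩ʳ_) nV vtx
    nF     : ℕ
    fc     : Fin nD → Fin nF
    fc-orbits  : OrbitLabelling (λ d → σ ⟨$⟩ʳ (α d)) nF fc

-- A planar map: connected, of genus 0, i.e. Euler's formula
-- V - E + F = 2 with E = nD / 2 (written as 2V + 2F = nD + 4).
record PlanarMap : Set where
  field
    map : Map
  open Map map public
  field
    connected : GConnected α vtx
    euler     : 2 * (nV + nF) ≡ nD + 4

-- Outerplanarity of the multigraph (Fin n, darts, α, lab):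
-- it has a plane embedding (a connected genus-0 rotation system σ' on
-- the same darts, same edges, same vertices) with a face incident to
-- every vertex.

Outerplanar : {nD n : ℕ} → (Fin nD → Fin nD) → (Fin nD → Fin n) → Set
Outerplanar {nD} {n} α lab =
  Σ (Permutation′ nD) λ σ' →
  Σ ℕ λ nF' →
  Σ (Fin nD → Fin nF') λ fc' →
    OrbitLabelling (σ' ⟨$⟩ʳ_) n lab ×
    OrbitLabelling (λ d → σ' ⟨$⟩ʳ (α d)) nF' fc' ×
    GConnected α lab ×
    2 * (n + nF') ≡ nD + 4 ×
    (Σ (Fin nF') λ f → (v : Fin n) → ∃[ d ] (lab d ≡ v × fc' d ≡ f))

module _ (M : PlanarMap) where
  open PlanarMap M

  Simple : Set
  Simple = GSimple α vtx

  TwoConnected : Set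
  TwoConnected = G2Connected α vtx

  WeaklyOuterplanar : Set
  WeaklyOuterplanar = Outerplanar α vtx

  -- The dual M* has the faces of M as vertices (rotation φ = σ ∘ α,
  -- same darts, same edge involution α), so its underlying graph has
  -- vertex labelling fc.  The dual is weakly outerplanar iff this
  -- graph is outerplanar.
  DualWeaklyOuterplanar : Set
  DualWeaklyOuterplanar = Outerplanar α fc

  VF : Set
  VF = Fin nV ⊎ Fin nF

  _≤VF_ : VF → VF → Set
  inj₁ v ≤VF inj₁ v' = v ≡ v'
  inj₂ f ≤VF inj₂ f' = f ≡ f'
  inj₁ v ≤VF inj₂ f  = ∃[ d ] (vtx d ≡ v × fc d ≡ f)
  inj₂ f ≤VF inj₁ v  = ⊥

  -- a realizer of size k: k linear orders (given by injective rank
  -- functions into ℕ) whose intersection is the order of P_VF(M)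
  Realizer : ℕ → Set
  Realizer k =
    Σ (Fin k → VF → ℕ) λ r →
      ((i : Fin k) → Injective _≡_ _≡_ (r i)) ×
      ((x y : VF) → (x ≤VF y → (i : Fin k) → r i x ≤ r i y) ×
                    (((i : Fin k) → r i x ≤ r i y) → x ≤VF y))

  DimVF≤ : ℕ → Set
  DimVF≤ k = ∃[ j ] (j ≤ k × Realizer j)

{-# OPTIONS --safe #-}
-- The outer face of an outerplane embedding of M is a Hamiltonian cycle C with pairwise noncrossing chords, and dually
-- the faces of M are linked by a Hamiltonian cycle C* of the dual.  Every edge lies in C or C*: contracting a chord of C
-- separates M, so deleting it separates the dual, which is impossible if C* avoids it.  By Euler's formula at least two
-- edges lie in both cycles, and cutting C at two of them leaves a top and a bottom path.  Deleting all of C* but one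
-- edge leaves M connected, so every edge of C* runs between the two paths; being noncrossing, these edges are linearly
-- ordered by nesting.  A face has exactly two edges of C*, and its vertices are those lying between them.  Hence a
-- vertex v not on f lies strictly inside the inner or strictly outside the outer of these two edges.  Ordering vertices
-- by the number of edges of C* they lie strictly inside of, and by the number they lie strictly outside of, gives two
-- linear extensions that put v above f in one of them; a third one reverses the two antichains.
--
-- Planarity enters through the genus inequality: if a face passes twice through a vertex, cutting the vertex along the
-- face raises V + F by two, so the map falls apart.
module Submission where

open import Defs hiding (here; step)
open import Algebra.Properties.CommutativeMonoid.Sum as Sum using ()
open import Data.Bool using (if_then_else_)
open import Data.Empty using (⊥; ⊥-elim)
open import Data.Fin using (Fin; zero; suc; toℕ; fromℕ<; punchIn; punchOut)
open import Data.Fin.Permutation as Perm using (Permutation′; _⟨$⟩ʳ_; _⟨$⟩ˡ_)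
open import Data.Fin.Permutation.Components using (transpose; transpose-inverse)
open import Data.Fin.Properties using (_≟_; any?; pigeonhole; injective⇒≤; toℕ<n; toℕ-fromℕ<; toℕ-injective; suc-injective; ¬Fin0)
open import Data.Fin.Properties using (punchOut-cong; punchOut-injective; punchOut-punchIn; punchInᵢ≢i)
open import Data.List using (List; []; _∷_; length; allFin; filter; lookup)
open import Data.List.Membership.Propositional using (_∈_)
open import Data.List.Membership.Propositional.Properties using (∈-allFin; ∈-filter⁺; ∈-filter⁻; ∈-lookup)
open import Data.List.Relation.Unary.All as All using (All; []; _∷_)
open import Data.List.Relation.Unary.AllPairs using (AllPairs; []; _∷_)
open import Data.List.Relation.Unary.Any as Any using (Any; here; there)
open import Data.Nat as ℕ using (ℕ; zero; suc; _+_; _*_; _∸_; _⊔_; _≤_; _<_; z≤n; s≤s; _≤?_; _<?_)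
import Data.Nat.Properties as ℕ
open import Data.Nat.Solver using (module +-*-Solver)
open import Data.Product using (Σ; ∃; ∃-syntax; _×_; _,_; proj₁; proj₂)
open import Data.Sum using (_⊎_; inj₁; inj₂; [_,_]′)
open import Data.Sum.Properties using (inj₁-injective; inj₂-injective)
open import Data.Unit using (⊤; tt)
open import Function using (_∘_)
open import Function.Definitions using (Injective)
open import Relation.Binary.Definitions using (tri<; tri≈; tri>)
open import Relation.Binary.PropositionalEquality using (_≡_; _≢_; refl; sym; trans; cong; cong₂; subst; module ≡-Reasoning)
open import Relation.Nullary using (¬_; Dec; yes; no; ¬?; does)
open import Relation.Nullary.Decidable using (dec-true; dec-false; decidable-stable; _⊎-dec_; _×-dec_)
open import Relation.Unary using (Decidable)

-- Injections and least witnesses.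

Inj : {A B : Set} → (A → B) → Set
Inj f = Injective _≡_ _≡_ f

least : {P : ℕ → Set} → Decidable P → ∀ k → P k →
        ∃[ j ] (P j × (∀ i → i < j → ¬ P i))
least P? k p with P? 0
least P? k p | yes p₀ = 0 , p₀ , λ _ ()
least P? zero p | no ¬p₀ = ⊥-elim (¬p₀ p)
least P? (suc k) p | no ¬p₀ with least (P? ∘ suc) k p
... | j , pj , min = suc j , pj , λ { zero _ → ¬p₀ ; (suc i) (s≤s i<j) → min i i<j }

-- Orbits

iter-shift : {A : Set} (f : A → A) → ∀ k x → iter f k (f x) ≡ f (iter f k x)
iter-shift f zero    x = refl
iter-shift f (suc k) x = cong f (iter-shift f k x)

iter-+ : {A : Set} (f : A → A) → ∀ j k x → iter f (j + k) x ≡ iter f j (iter f k x)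
iter-+ f zero    k x = refl
iter-+ f (suc j) k x = cong f (iter-+ f j k x)

iter-injective : {A : Set} {f : A → A} → Inj f → ∀ k → Inj (iter f k)
iter-injective inj zero    eq = eq
iter-injective inj (suc k) eq = iter-injective inj k (inj eq)

iter-cong : {A : Set} {f g : A → A} → (∀ x → f x ≡ g x) → ∀ k x → iter f k x ≡ iter g k x
iter-cong         eq zero    x = refl
iter-cong {f = f} eq (suc k) x = trans (cong f (iter-cong eq k x)) (eq _)

orbit-trans : {A : Set} {f : A → A} {x y z : A} →
              SameOrbit f x y → SameOrbit f y z → SameOrbit f x z
orbit-trans {f = f} {x} (j , p) (k , q) =
  k + j , trans (iter-+ f k j x) (trans (cong (iter f k) p) q)

-- The induction stops at the first visit of `x`, so an invariant can be carried up to the very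
-- point where it may break.
walk : ∀ {n} {f : Fin n → Fin n} (P : Fin n → Set) {x y : Fin n} →
       (∀ z → z ≢ x → P z → P (f z)) → SameOrbit f y x → P y → P x
walk {f = f} P {x} {y} advance (k , eq) p = go k y eq p
  where
  go : ∀ k y → iter f k y ≡ x → P y → P x
  go zero    y eq p = subst P eq p
  go (suc k) y eq p with y ≟ x
  ... | yes y≡x = subst P y≡x p
  ... | no  y≢x = go k (f y) (trans (iter-shift f k y) eq) (advance y y≢x p)

module _ {n : ℕ} {f : Fin n → Fin n} (inj : Inj f) where

  -- Two iterates of `x` coincide by the pigeonhole principle, and injectivity cancels their common
  -- prefix.
  orbit-return : ∀ x → SameOrbit f (f x) x
  orbit-return x with pigeonhole (ℕ.n<1+n n) (λ i → iter f (toℕ i) x)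
  ... | i , j , i<j , eq = k , sym (iter-injective inj a (trans eq (trans (cong (λ m → iter f m x) b≡)
        (trans (iter-+ f a (suc k) x) (cong (iter f a) (sym (iter-shift f k x)))))))
    where
    a = toℕ i
    k = toℕ j ∸ suc a
    b≡ : toℕ j ≡ a + suc k
    b≡ = trans (sym (ℕ.m+[n∸m]≡n i<j)) (sym (ℕ.+-suc a k))

  orbit-sym : ∀ {x y} → SameOrbit f x y → SameOrbit f y x
  orbit-sym {x} (k , refl) = go k
    where
    go : ∀ k → SameOrbit f (iter f k x) x
    go zero    = 0 , refl
    go (suc k) = orbit-trans (orbit-return (iter f k x)) (go k)

  predecessor : ∀ x → ∃[ w ] (f w ≡ x × SameOrbit f x w)
  predecessor x with orbit-return x
  ... | zero  , eq = x , eq , 0 , refl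
  ... | suc k , eq = iter f k (f x) , eq , suc k , sym (iter-shift f k x)

lab-step : ∀ {n m} {f : Fin n → Fin n} {lab : Fin n → Fin m} → OrbitLabelling f m lab →
           ∀ d → lab (f d) ≡ lab d
lab-step ol d = sym (OrbitLabelling.⇒sameLab ol d _ (1 , refl))

labelling-cong : ∀ {n m} {f g : Fin n → Fin n} {lab : Fin n → Fin m} → (∀ x → f x ≡ g x) →
                 OrbitLabelling f m lab → OrbitLabelling g m lab
labelling-cong eq ol = record
  { surj     = surj
  ; sameLab⇒ = λ d d' p → let k , q = sameLab⇒ d d' p in k , trans (sym (iter-cong eq k d)) q
  ; ⇒sameLab = λ d d' (k , q) → ⇒sameLab d d' (k , trans (iter-cong eq k d) q)
  }
  where open OrbitLabelling ol

invariant⇒constant : ∀ {n m} {f : Fin n → Fin n} {c : Fin n → Fin m} → (∀ x → c (f x) ≡ c x) →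
                     ∀ {x y} → SameOrbit f x y → c x ≡ c y
invariant⇒constant {f = f} {c} inv {x} (k , refl) = sym (go k)
  where
  go : ∀ k → c (iter f k x) ≡ c x
  go zero    = refl
  go (suc k) = trans (inv _) (go k)

-- Transpositions

module _ {n : ℕ} (x y : Fin n) where

  transpose-fst : transpose x y x ≡ y
  transpose-fst rewrite dec-true (x ≟ x) refl = refl

  transpose-snd : transpose x y y ≡ x
  transpose-snd with y ≟ x
  ... | yes y≡x = y≡x
  ... | no  _   rewrite dec-true (y ≟ y) refl = refl

  transpose-other : ∀ {z} → z ≢ x → z ≢ y → transpose x y z ≡ z
  transpose-other {z} z≢x z≢y rewrite dec-false (z ≟ x) z≢x | dec-false (z ≟ y) z≢y = refl

transpose-injective : ∀ {n} (x y : Fin n) → Inj (transpose x y)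
transpose-injective x y {a} {b} eq =
  trans (sym (transpose-inverse y x)) (trans (cong (transpose y x) eq) (transpose-inverse y x))

-- Conjugation by `f`. It turns a swap of corners after `σ` into a swap of darts before `σ`, the
-- form in which edges enter `swaps`.
transpose-natural : ∀ {n} {f : Fin n → Fin n} → Inj f → ∀ a b z →
                    transpose (f a) (f b) (f z) ≡ f (transpose a b z)
transpose-natural {f = f} inj a b z with z ≟ a
... | yes refl = transpose-fst (f a) (f b)
... | no z≢a with z ≟ b
... | yes refl = transpose-snd (f a) (f b)
... | no z≢b = transpose-other (f a) (f b) (z≢a ∘ inj) (z≢b ∘ inj)

transpose-invariant : ∀ {n k} {c : Fin n → Fin k} {a b} → c a ≡ c b → ∀ z → c (transpose a b z) ≡ c z
transpose-invariant {a = a} {b} eq z with z ≟ a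
... | yes refl = sym eq
... | no z≢a with z ≟ b
... | yes refl = eq
... | no z≢b = refl

transpose-comm : ∀ {n} (x y z : Fin n) → transpose x y z ≡ transpose y x z
transpose-comm x y z = cases (z ≟ x) (z ≟ y)
  where
  cases : Dec (z ≡ x) → Dec (z ≡ y) → transpose x y z ≡ transpose y x z
  cases (yes refl) _          = trans (transpose-fst x y) (sym (transpose-snd y x))
  cases (no _)     (yes refl) = trans (transpose-snd x y) (sym (transpose-fst y x))
  cases (no p)     (no q)     = trans (transpose-other x y p q) (sym (transpose-other y x q p))

-- Splitting and merging orbits by a transposition

mergeLabels : ∀ {m} {i j : Fin (suc m)} → i ≢ j → Σ (Fin (suc m) → Fin m) λ g →
              (g i ≡ g j) ×
              (∀ a b → g a ≡ g b → a ≡ b ⊎ ((a ≡ i ⊎ a ≡ j) × (b ≡ i ⊎ b ≡ j))) ×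
              (∀ c → ∃[ a ] g a ≡ c)
mergeLabels {m} {i} {j} i≢j = g , gi≡gj , fibres , λ c → punchIn j c , hit c
  where
  g : Fin (suc m) → Fin m
  g a with a ≟ j
  ... | yes _   = punchOut (i≢j ∘ sym)
  ... | no  a≢j = punchOut (a≢j ∘ sym)
  gi≡gj : g i ≡ g j
  gi≡gj with i ≟ j | j ≟ j
  ... | yes p | _     = ⊥-elim (i≢j p)
  ... | no _  | no q  = ⊥-elim (q refl)
  ... | no _  | yes _ = punchOut-cong j refl
  fibres : ∀ a b → g a ≡ g b → a ≡ b ⊎ ((a ≡ i ⊎ a ≡ j) × (b ≡ i ⊎ b ≡ j))
  fibres a b eq with a ≟ j | b ≟ j
  ... | yes p | yes q = inj₁ (trans p (sym q))
  ... | yes p | no q  = inj₂ (inj₂ p , inj₁ (sym (punchOut-injective (i≢j ∘ sym) (q ∘ sym) eq)))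
  ... | no p  | yes q = inj₂ (inj₁ (punchOut-injective (p ∘ sym) (i≢j ∘ sym) eq) , inj₂ q)
  ... | no p  | no q  = inj₁ (punchOut-injective (p ∘ sym) (q ∘ sym) eq)
  hit : ∀ c → g (punchIn j c) ≡ c
  hit c with punchIn j c ≟ j
  ... | yes p = ⊥-elim (punchInᵢ≢i j c p)
  ... | no  _ = trans (punchOut-cong j refl) (punchOut-punchIn j)

module _ {n m : ℕ} {π : Fin n → Fin n} (inj : Inj π) {lab : Fin n → Fin m}
         (ol : OrbitLabelling π m lab) (x y : Fin n) where

  open OrbitLabelling ol

  private
    π′ : Fin n → Fin n
    π′ z = transpose x y (π z)
    inj′ : Inj π′
    inj′ eq = inj (transpose-injective x y eq)

  untouched : ∀ {d d'} → lab d ≢ lab x → lab d ≢ lab y → SameOrbit π d d' → SameOrbit π′ d d'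
  untouched {d} ≢x ≢y (k , refl) = k , sym (go k)
    where
    lab-iter : ∀ k → lab (iter π k d) ≡ lab d
    lab-iter k = sym (⇒sameLab d _ (k , refl))
    go : ∀ k → iter π k d ≡ iter π′ k d
    go zero    = refl
    go (suc k) = trans (sym (transpose-other x y (λ e → ≢x (trans (sym (lab-iter (suc k))) (cong lab e)))
                                                 (λ e → ≢y (trans (sym (lab-iter (suc k))) (cong lab e)))))
                       (cong π′ (go k))

  -- Following π from d, the first deviation of π′ happens just before x, where π′ jumps to y.
  detour : (Q : Fin n → Set) → (∀ z → π z ≢ x → Q z → π z ≢ y × Q (π z)) →
           ∀ {d} → SameOrbit π d x → Q d → SameOrbit π′ d y
  detour Q advance {d} d~x q with predecessor inj x
  ... | w , πw≡x , x~w = orbit-trans (proj₂ reach) (1 , trans (cong (transpose x y) πw≡x) (transpose-fst x y))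
    where
    reach : Q w × SameOrbit π′ d w
    reach = walk (λ z → Q z × SameOrbit π′ d z)
      (λ z z≢w (qz , d~z) →
        let πz≢x = λ e → z≢w (inj (trans e (sym πw≡x)))
            πz≢y , qπz = advance z πz≢x qz
        in qπz , orbit-trans d~z (1 , transpose-other x y πz≢x πz≢y))
      (orbit-trans d~x x~w) (q , 0 , refl)

  -- Let `k` be the first time at which the orbit of `x` reaches `y`. The segment `S` from `x` up to
  -- just before `y` closes up under `π′`, because its last point is redirected to `x`. It receives
  -- the new label `zero`; the rest of the orbit, with `y`, keeps the old one.
  split : x ≢ y → lab x ≡ lab y → Σ (Fin n → Fin (suc m)) λ lab′ → OrbitLabelling π′ (suc m) lab′
  split x≢y same with least (λ k → iter π k x ≟ y) (proj₁ (sameLab⇒ x y same)) (proj₂ (sameLab⇒ x y same))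
  ... | zero  , x≡y , _ = ⊥-elim (x≢y x≡y)
  ... | suc l , hit , first = lab′ , record
    { surj     = surj′
    ; sameLab⇒ = sameLab⇒′
    ; ⇒sameLab = λ d d' → invariant⇒constant {f = π′} {lab′} lab′-step
    }
    where
    k = suc l
    S : Fin n → Set
    S d = ∃ λ (i : Fin k) → iter π (toℕ i) x ≡ d
    S? : Decidable S
    S? d = any? (λ i → iter π (toℕ i) x ≟ d)
    mkS : ∀ i {d} → i < k → iter π i x ≡ d → S d
    mkS i i<k eq = fromℕ< i<k , trans (cong (λ j → iter π j x) (toℕ-fromℕ< i<k)) eq

    y∉S : ¬ S y
    y∉S (i , eq) = first (toℕ i) (toℕ<n i) eq
    x∈S : S x
    x∈S = zero , refl
    S-forward : ∀ {d} → π d ≢ y → S d → S (π d)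
    S-forward {d} πd≢y (i , eq) with ℕ.m≤n⇒m<n∨m≡n (toℕ<n i)
    ... | inj₁ lt = mkS (suc (toℕ i)) lt (cong π eq)
    ... | inj₂ e  = ⊥-elim (πd≢y (trans (sym (trans (cong (λ j → iter π j x) (sym e)) (cong π eq))) hit))
    S-backward : ∀ {d} → π d ≢ x → S (π d) → S d
    S-backward πd≢x (zero  , eq) = ⊥-elim (πd≢x (sym eq))
    S-backward πd≢x (suc i , eq) = mkS (toℕ i) (ℕ.m<n⇒m<1+n (toℕ<n i)) (inj eq)
    -- If the orbit came back to `x` within the segment, dropping that loop would reach `y` too
    -- early.
    before-x : ∀ {d} → π d ≡ x → ¬ S d
    before-x {d} πd≡x (i , eq) = first (l ∸ toℕ i) (s≤s (ℕ.m∸n≤m l (toℕ i)))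
      (trans (cong (iter π (l ∸ toℕ i)) (sym (trans (cong π eq) πd≡x)))
        (trans (sym (iter-+ π (l ∸ toℕ i) (suc (toℕ i)) x))
          (trans (cong (λ j → iter π j x) (trans (ℕ.+-suc (l ∸ toℕ i) (toℕ i))
              (cong suc (ℕ.m∸n+n≡m (ℕ.≤-pred (toℕ<n i)))))) hit)))
    before-y : ∀ {d} → π d ≡ y → S d
    before-y πd≡y = mkS l (ℕ.n<1+n l) (inj (trans hit (sym πd≡y)))
    S-lab : ∀ {d} → S d → lab d ≡ lab x
    S-lab (i , eq) = sym (⇒sameLab x _ (toℕ i , eq))

    lab′ : Fin n → Fin (suc m)
    lab′ d with S? d
    ... | yes _ = zero
    ... | no  _ = suc (lab d)
    lab′-∈ : ∀ {d} → S d → lab′ d ≡ zero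
    lab′-∈ {d} s with S? d
    ... | yes _ = refl
    ... | no ¬s = ⊥-elim (¬s s)
    lab′-∉ : ∀ {d} → ¬ S d → lab′ d ≡ suc (lab d)
    lab′-∉ {d} ¬s with S? d
    ... | yes s = ⊥-elim (¬s s)
    ... | no _  = refl

    lab′-step : ∀ d → lab′ (π′ d) ≡ lab′ d
    lab′-step d = cases (π d ≟ x) (π d ≟ y) (S? d)
      where
      cases : Dec (π d ≡ x) → Dec (π d ≡ y) → Dec (S d) → lab′ (π′ d) ≡ lab′ d
      cases (yes p) _ _ =
        trans (cong lab′ (trans (cong (transpose x y) p) (transpose-fst x y)))
          (trans (lab′-∉ y∉S)
            (trans (cong suc (trans (sym same) (trans (cong lab (sym p)) (lab-step ol d))))
              (sym (lab′-∉ (before-x p)))))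
      cases (no _) (yes q) _ =
        trans (cong lab′ (trans (cong (transpose x y) q) (transpose-snd x y)))
          (trans (lab′-∈ x∈S) (sym (lab′-∈ (before-y q))))
      cases (no p) (no q) (yes s) =
        trans (cong lab′ (transpose-other x y p q)) (trans (lab′-∈ (S-forward q s)) (sym (lab′-∈ s)))
      cases (no p) (no q) (no ¬s) =
        trans (cong lab′ (transpose-other x y p q))
          (trans (lab′-∉ (¬s ∘ S-backward p)) (trans (cong suc (lab-step ol d)) (sym (lab′-∉ ¬s))))

    surj′ : ∀ j → ∃[ d ] lab′ d ≡ j
    surj′ zero    = x , lab′-∈ x∈S
    surj′ (suc j) with j ≟ lab y
    ... | yes p = y , trans (lab′-∉ y∉S) (cong suc (sym p))
    ... | no p with surj j
    ... | d , eq = d , trans (lab′-∉ (λ s → p (trans (sym eq) (trans (S-lab s) same)))) (cong suc eq)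

    to-y : ∀ {d} → ¬ S d → lab d ≡ lab x → SameOrbit π′ d y
    to-y {d} ¬s eq = detour (λ z → ¬ S z)
      (λ z πz≢x ¬sz → (λ e → ¬sz (before-y e)) , ¬sz ∘ S-backward πz≢x) (sameLab⇒ d x eq) ¬s
    from-x : ∀ i → i < k → SameOrbit π′ x (iter π i x)
    from-x zero    _   = 0 , refl
    from-x (suc i) i<k = orbit-trans (from-x i (ℕ.<-trans (ℕ.n<1+n i) i<k))
      (1 , transpose-other x y (λ e → before-x e (mkS i (ℕ.<-trans (ℕ.n<1+n i) i<k) refl)) (first (suc i) i<k))
    from-x′ : ∀ {d} → S d → SameOrbit π′ x d
    from-x′ (i , refl) = from-x (toℕ i) (toℕ<n i)

    sameLab⇒′ : ∀ d d' → lab′ d ≡ lab′ d' → SameOrbit π′ d d'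
    sameLab⇒′ d d' eq with S? d | S? d'
    ... | yes s | yes s' = orbit-trans (orbit-sym inj′ (from-x′ s)) (from-x′ s')
    ... | no ¬s | no ¬s' with lab d ≟ lab x
    ...   | yes p = orbit-trans (to-y ¬s p) (orbit-sym inj′ (to-y ¬s' (trans (sym (suc-injective eq)) p)))
    ...   | no  p = untouched p (λ q → p (trans q (sym same))) (sameLab⇒ d d' (suc-injective eq))

-- By `detour`, each of the two old orbits now runs on into the other.
merge : ∀ {n m} {π : Fin n → Fin n} (inj : Inj π) {lab : Fin n → Fin m}
        (ol : OrbitLabelling π m lab) {x y : Fin n} → lab x ≢ lab y →
        ∃[ m' ] (m ≡ suc m' × Σ (Fin m → Fin m') λ g →
          g (lab x) ≡ g (lab y) × OrbitLabelling (λ z → transpose x y (π z)) m' (g ∘ lab))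
merge {m = zero}  inj {lab} ol {x} _ = ⊥-elim (¬Fin0 (lab x))
merge {n} {suc m'} {π} inj {lab} ol {x} {y} ≢ with mergeLabels ≢
... | g , gx≡gy , fibres , onto = m' , refl , g , gx≡gy , record
    { surj     = λ j → let a , ga = onto j ; d , e = surj a in d , trans (cong g e) ga
    ; sameLab⇒ = sameLab⇒′
    ; ⇒sameLab = λ d d' → invariant⇒constant {f = π′} {g ∘ lab}
        (λ z → trans (transpose-invariant {c = g ∘ lab} gx≡gy (π z)) (cong g (lab-step ol z)))
    }
  where
  open OrbitLabelling ol
  π′ : Fin n → Fin n
  π′ z = transpose x y (π z)
  inj′ : Inj π′
  inj′ eq = inj (transpose-injective x y eq)

  x→y : ∀ {d} → lab d ≡ lab x → SameOrbit π′ d y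
  x→y {d} eq = detour inj ol x y (λ z → lab z ≡ lab x)
    (λ z _ e → let e' = trans (lab-step ol z) e in (λ p → ≢ (trans (sym e') (cong lab p))) , e') (sameLab⇒ d x eq) eq
  y→x : ∀ {d} → lab d ≡ lab y → SameOrbit π′ d x
  y→x {d} eq with detour inj ol y x (λ z → lab z ≡ lab y)
    (λ z _ e → let e' = trans (lab-step ol z) e in (λ p → ≢ (sym (trans (sym e') (cong lab p)))) , e')
                     (sameLab⇒ d y eq) eq
  ... | k , e = k , trans (iter-cong (λ z → transpose-comm x y (π z)) k d) e
  to-y : ∀ {d} → lab d ≡ lab x ⊎ lab d ≡ lab y → SameOrbit π′ d y
  to-y (inj₁ e) = x→y e
  to-y (inj₂ e) = orbit-trans (y→x e) (x→y refl)

  sameLab⇒′ : ∀ d d' → g (lab d) ≡ g (lab d') → SameOrbit π′ d d'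
  sameLab⇒′ d d' eq with fibres _ _ eq
  ... | inj₂ (p , q) = orbit-trans (to-y p) (orbit-sym inj′ (to-y q))
  ... | inj₁ e with lab d ≟ lab x | lab d ≟ lab y
  ... | yes p | _ = orbit-trans (to-y (inj₁ p)) (orbit-sym inj′ (to-y (inj₁ (trans (sym e) p))))
  ... | no _ | yes p = orbit-trans (to-y (inj₂ p)) (orbit-sym inj′ (to-y (inj₂ (trans (sym e) p))))
  ... | no p | no q = untouched inj ol x y p q (sameLab⇒ d d' e)

-- The genus inequality

module _ {n : ℕ} (α : Fin n → Fin n) where

  -- The edge involution as a product of transpositions, so that edges can be peeled off one at a
  -- time.
  swaps : List (Fin n) → Fin n → Fin n
  swaps []       x = x
  swaps (d ∷ ds) x = transpose d (α d) (swaps ds x)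

  swaps-invariant : ∀ {k} {c : Fin n → Fin k} {ds} → All (λ d → c d ≡ c (α d)) ds → ∀ x → c (swaps ds x) ≡ c x
  swaps-invariant []       x = refl
  swaps-invariant {c = c} {d ∷ ds} (p ∷ ps) x =
    trans (transpose-invariant {c = c} p (swaps ds x)) (swaps-invariant {c = c} ps x)

  unswap : ∀ {k} {σ : Fin n → Fin n} {c : Fin n → Fin k} {d} → c d ≡ c (α d) →
           (∀ x → c (σ (transpose d (α d) x)) ≡ c x) → ∀ x → c (σ x) ≡ c x
  unswap {σ = σ} {c} {d} eq inv x =
    trans (cong (c ∘ σ) (sym (transpose-inverse d (α d))))
      (trans (inv _) (trans (cong c (transpose-comm (α d) d x)) (transpose-invariant {c = c} eq x)))

  -- Induction on ds, absorbing its first transposition into σ: this merges or splits one orbit of σ.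
  -- A merge joins d and α d inside one σ-orbit, hence leaves the components unchanged.
  module _ (α-free : ∀ d → α d ≢ d) where

    genus : ∀ (ds : List (Fin n)) (σ : Fin n → Fin n) → Inj σ →
            ∀ {V F} {lab : Fin n → Fin V} {flab : Fin n → Fin F} → OrbitLabelling σ V lab →
            (∀ j → ∃[ d ] flab d ≡ j) → (∀ x → flab (σ (swaps ds x)) ≡ flab x) →
            Σ ℕ λ k → Σ (Fin n → Fin k) λ comp →
              (∀ j → ∃[ d ] comp d ≡ j) × (∀ x → comp (σ x) ≡ comp x) ×
              All (λ d → comp d ≡ comp (α d)) ds × V + F ≤ length ds + 2 * k
    genus [] σ inj {V} {F} {lab} {flab} ol onto inv with ℕ.≤-total F V
    -- With no edges left, `lab` and `flab` are both invariant under `σ`; the one with more labels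
    -- serves as `comp`, whence `V + F ≤ 2 * k`.
    ... | inj₁ F≤V = V , lab , OrbitLabelling.surj ol , lab-step ol , [] ,
                     ℕ.+-monoʳ-≤ V (ℕ.≤-trans F≤V (ℕ.m≤m+n V 0))
    ... | inj₂ V≤F = F , flab , onto , inv , [] , ℕ.+-mono-≤ V≤F (ℕ.m≤m+n F 0)
    genus (d ∷ ds) σ inj {V} {F} {lab} {flab} ol onto inv = cases (lab (σ d) ≟ lab (σ (α d)))
      where
      Goal : List (Fin n) → (Fin n → Fin n) → ℕ → Set
      Goal ds σ V = Σ ℕ λ k → Σ (Fin n → Fin k) λ comp →
        (∀ j → ∃[ d ] comp d ≡ j) × (∀ x → comp (σ x) ≡ comp x) ×
        All (λ d → comp d ≡ comp (α d)) ds × V + F ≤ length ds + 2 * k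
      σ₁ : Fin n → Fin n
      σ₁ z = σ (transpose d (α d) z)
      σ₁-inj : Inj σ₁
      σ₁-inj eq = transpose-injective d (α d) (inj eq)
      to-σ₁ : ∀ {m} {lab : Fin n → Fin m} →
              OrbitLabelling (λ z → transpose (σ d) (σ (α d)) (σ z)) m lab → OrbitLabelling σ₁ m lab
      to-σ₁ = labelling-cong (transpose-natural inj d (α d))
      open +-*-Solver
      arith : ∀ l k → l + 2 * suc k ≡ suc (suc l + 2 * k)
      arith = solve 2 (λ l k → l :+ con 2 :* (con 1 :+ k) := con 1 :+ ((con 1 :+ l) :+ con 2 :* k)) refl

      join : Goal ds σ₁ (suc V) → Goal (d ∷ ds) σ V
      join (k , comp , surj , comp-inv , es-inv , le) with comp d ≟ comp (α d)
      ... | yes eq = k , comp , surj , unswap {σ = σ} {comp} eq comp-inv , eq ∷ es-inv ,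
                     ℕ.≤-trans (ℕ.n≤1+n _) (ℕ.≤-trans le (ℕ.n≤1+n _))
      join (zero , comp , _) | no _ = ⊥-elim (¬Fin0 (comp d))
      -- Gluing two components lowers the bound by 2. The vertex gained by the split and the edge
      -- `d` pay for it.
      join (suc k , comp , surj , comp-inv , es-inv , le) | no neq with mergeLabels neq
      ... | g , eq , _ , g-onto =
        k , g ∘ comp , (λ j → let a , ga = g-onto j ; z , e = surj a in z , trans (cong g e) ga) ,
        unswap {σ = σ} {g ∘ comp} eq (cong g ∘ comp-inv) , eq ∷ All.map (cong g) es-inv ,
        ℕ.≤-pred (ℕ.≤-trans le (ℕ.≤-reflexive (arith (length ds) k)))

      cases : Dec (lab (σ d) ≡ lab (σ (α d))) → Goal (d ∷ ds) σ V
      cases (yes same) =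
        let _ , ol′ = split inj ol (σ d) (σ (α d)) (λ e → α-free d (sym (inj e))) same
        in join (genus ds σ₁ σ₁-inj (to-σ₁ ol′) onto inv)
      cases (no differ) =
        let _ , V≡ , g , g≡ , ol′ = merge inj ol differ
            k , comp , surj , comp-inv , es-inv , le =
              genus ds σ₁ σ₁-inj {lab = g ∘ lab} (to-σ₁ ol′) onto inv
            same : comp d ≡ comp (α d)
            same = invariant⇒constant {c = comp} comp-inv (OrbitLabelling.sameLab⇒ (to-σ₁ ol′) d (α d)
              (trans (cong g (sym (lab-step ol d))) (trans g≡ (cong g (lab-step ol (α d))))))
        in k , comp , surj , unswap {σ = σ} {comp} same comp-inv , same ∷ es-inv ,
           subst (λ v → v + F ≤ suc (length ds + 2 * k)) (sym V≡) (s≤s le)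

swaps-injective : ∀ {n} (α : Fin n → Fin n) ds → Inj (swaps α ds)
swaps-injective α []       eq = eq
swaps-injective α (d ∷ ds) eq = swaps-injective α ds (transpose-injective d (α d) eq)

-- A form of planarity stable under contraction: `β` may fix dummy darts left by a contracted edge
-- and acts as the edge involution on the others. Euler's formula is kept as the lower bound on
-- `V + F`, the direction that clashes with `genus`. Connectedness says that invariant colourings
-- are constant.
record Planar {n V F : ℕ} (σ β : Fin n → Fin n) (lab : Fin n → Fin V) (flab : Fin n → Fin F) : Set where
  field
    σ-inj      : Inj σ
    vertices   : OrbitLabelling σ V lab
    faces      : OrbitLabelling (σ ∘ β) F flab
    α          : Fin n → Fin n
    α-free     : ∀ d → α d ≢ d
    edges      : List (Fin n)
    edges-β    : ∀ x → swaps α edges x ≡ β x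
    euler      : length edges + 2 ≤ V + F
    connected  : ∀ {k} (c : Fin n → Fin k) → (∀ x → c (σ x) ≡ c x) → (∀ x → c (β x) ≡ c x) → ∀ x y → c x ≡ c y

  φ-inj : Inj (σ ∘ β)
  φ-inj {a} {b} eq = swaps-injective α edges (trans (edges-β a) (trans (σ-inj eq) (sym (edges-β b))))

-- The Jordan curve through the corners x and y: cutting the vertex along it would raise V + F by two.
jordan : ∀ {n V F} {σ β : Fin n → Fin n} {lab : Fin n → Fin V} {flab : Fin n → Fin F} →
         Planar σ β lab flab → ∀ {x y} → x ≢ y → lab x ≡ lab y → flab x ≡ flab y →
         Σ ℕ λ k → Σ (Fin n → Fin k) λ c →
           c x ≢ c y × (∀ z → c (transpose x y (σ z)) ≡ c z) × (∀ z → c (β z) ≡ c z)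
jordan {V = V} {F} {σ} {β} P {x} {y} x≢y vxy fxy
  with split σ-inj vertices x y x≢y vxy | split φ-inj faces x y x≢y fxy
  where open Planar P
... | lab′ , ol | flab′ , fol with genus α α-free edges (λ z → transpose x y (σ z))
    (λ eq → σ-inj (transpose-injective x y eq)) ol (OrbitLabelling.surj fol)
                                   (λ z → trans (cong (λ w → flab′ (transpose x y (σ w))) (edges-β z)) (lab-step fol z))
  where open Planar P
... | zero , c , surj , σ~-inv , es-inv , le = ⊥-elim (¬Fin0 (c x))
-- With a single component, the two orbits gained by the splits violate Euler's formula.
... | suc zero , c , surj , σ~-inv , es-inv , le = ⊥-elim (ℕ.<-irrefl refl (begin-strict
      len + 2             ≤⟨ euler ⟩
      V + F               <⟨ ℕ.+-monoʳ-< V (ℕ.n<1+n F) ⟩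
      V + suc F           <⟨ ℕ.n<1+n _ ⟩
      suc V + suc F       ≤⟨ le ⟩
      len + 2             ∎))
  where
  open Planar P
  open ℕ.≤-Reasoning
  len = length edges
... | k@(suc (suc k₀)) , c , surj , σ~-inv , es-inv , le = k , c , differ , σ~-inv , β-inv
  where
  open Planar P
  β-inv : ∀ z → c (β z) ≡ c z
  β-inv z = trans (cong c (sym (edges-β z))) (swaps-invariant α {c = c} es-inv z)
  -- If `x` and `y` had one colour, undoing the cut would make `c` an invariant colouring of the
  -- connected original, yet `c` takes at least two values.
  differ : c x ≢ c y
  differ eq with surj zero | surj (suc zero)
  ... | a , ca | b , cb with trans (sym ca) (trans (connected c
      (λ z → trans (sym (transpose-invariant {c = c} eq (σ z))) (σ~-inv z)) β-inv a b) cb)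
  ... | ()

-- Lists of edge representatives

module EdgeList {n : ℕ} (α : Fin n → Fin n) (invol : ∀ d → α (α d) ≡ d) (α-free : ∀ d → α d ≢ d) where

  α-inj : Inj α
  α-inj eq = trans (sym (invol _)) (trans (cong α eq) (invol _))

  Touches : Fin n → Fin n → Set
  Touches x d = x ≡ d ⊎ x ≡ α d

  touches? : ∀ x → Decidable (Touches x)
  touches? x d = (x ≟ d) ⊎-dec (x ≟ α d)

  Touched : Fin n → List (Fin n) → Set
  Touched x = Any (Touches x)

  touched? : ∀ x → Decidable (Touched x)
  touched? x = Any.any? (touches? x)

  touches-α : ∀ {x d} → Touches (α x) d → Touches x d
  touches-α (inj₁ e) = inj₂ (trans (sym (invol _)) (cong α e))
  touches-α (inj₂ e) = inj₁ (α-inj e)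

  data Independent : List (Fin n) → Set where
    []  : Independent []
    _∷_ : ∀ {d ds} → ¬ Touched d ds → Independent ds → Independent (d ∷ ds)

  swaps-untouched : ∀ {ds x} → ¬ Touched x ds → swaps α ds x ≡ x
  swaps-untouched {[]}     _  = refl
  swaps-untouched {d ∷ ds} ¬t = trans (cong (transpose d (α d)) (swaps-untouched (¬t ∘ there)))
    (transpose-other d (α d) (¬t ∘ here ∘ inj₁) (¬t ∘ here ∘ inj₂))

  swaps-touched : ∀ {ds x} → Independent ds → Touched x ds → swaps α ds x ≡ α x
  swaps-touched {d ∷ ds} (¬t ∷ _) (here (inj₁ refl)) =
    trans (cong (transpose d (α d)) (swaps-untouched ¬t)) (transpose-fst d (α d))
  swaps-touched {d ∷ ds} (¬t ∷ _) (here (inj₂ refl)) =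
    trans (cong (transpose d (α d)) (swaps-untouched (¬t ∘ Any.map touches-α)))
        (trans (transpose-snd d (α d)) (sym (invol d)))
  swaps-touched {d ∷ ds} {x} (¬t ∷ ind) (there t) = trans (cong (transpose d (α d)) (swaps-touched ind t))
    (transpose-other d (α d) (λ e → ¬t (Any.map touches-α (subst (λ z → Touched z ds)
        (trans (sym (invol x)) (cong α e)) t)))
                             (λ e → ¬t (subst (λ z → Touched z ds) (α-inj e) t)))

  doubled : List (Fin n) → List (Fin n)
  doubled []       = []
  doubled (d ∷ ds) = d ∷ α d ∷ doubled ds

  length-doubled : ∀ ds → length (doubled ds) ≡ length ds + length ds
  length-doubled []       = refl
  length-doubled (d ∷ ds) = cong suc (trans (cong suc (length-doubled ds)) (sym (ℕ.+-suc _ _)))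

  untouched⇒All : ∀ {x ds} → ¬ Touched x ds → All (x ≢_) (doubled ds)
  untouched⇒All {ds = []}     _  = []
  untouched⇒All {ds = d ∷ ds} ¬t = (¬t ∘ here ∘ inj₁) ∷ (¬t ∘ here ∘ inj₂) ∷ untouched⇒All (¬t ∘ there)

  doubled-unique : ∀ {ds} → Independent ds → AllPairs _≢_ (doubled ds)
  doubled-unique []         = []
  doubled-unique (¬t ∷ ind) = ((α-free _ ∘ sym) ∷ untouched⇒All ¬t) ∷ untouched⇒All
      (¬t ∘ Any.map touches-α) ∷ doubled-unique ind

  lookup-injective : ∀ {xs : List (Fin n)} → AllPairs _≢_ xs → Inj (lookup xs)
  lookup-injective (p ∷ ps) {zero}  {zero}  eq = refl
  lookup-injective (p ∷ ps) {zero}  {suc j} eq = ⊥-elim (All.lookup p (∈-lookup j) eq)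
  lookup-injective (p ∷ ps) {suc i} {zero}  eq = ⊥-elim (All.lookup p (∈-lookup i) (sym eq))
  lookup-injective (p ∷ ps) {suc i} {suc j} eq = cong suc (lookup-injective ps eq)

  -- `doubled` lists both darts of every edge without repetition.
  independent-length : ∀ {ds} → Independent ds → length ds + length ds ≤ n
  independent-length {ds} ind =
    subst (_≤ n) (length-doubled ds) (injective⇒≤ (lookup-injective (doubled-unique ind)))

  select : List (Fin n) → List (Fin n)
  select [] = []
  select (x ∷ xs) with touched? x (select xs)
  ... | yes _ = select xs
  ... | no  _ = x ∷ select xs

  select-independent : ∀ xs → Independent (select xs)
  select-independent [] = []
  select-independent (x ∷ xs) with touched? x (select xs)
  ... | yes _ = select-independent xs
  ... | no ¬t = ¬t ∷ select-independent xs

  select-covers : ∀ {x} xs → x ∈ xs → Touched x (select xs)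
  select-covers (x ∷ xs) (here refl) with touched? x (select xs)
  ... | yes t = t
  ... | no  _ = here (inj₁ refl)
  select-covers (y ∷ xs) (there x∈) with touched? y (select xs)
  ... | yes _ = select-covers xs x∈
  ... | no  _ = there (select-covers xs x∈)

  select-All : ∀ {P : Fin n → Set} xs → (∀ {x} → x ∈ xs → P x) → All P (select xs)
  select-All [] _ = []
  select-All (x ∷ xs) p with touched? x (select xs)
  ... | yes _ = select-All xs (p ∘ there)
  ... | no  _ = p (here refl) ∷ select-All xs (p ∘ there)

  module _ (e : Fin n) where

    -- The edge involution after contraction of `e`. Its two darts survive as fixed points, so the
    -- set of darts does not change.
    bypass : Fin n → Fin n
    bypass x with touches? x e
    ... | yes _ = x
    ... | no  _ = α x

    bypass-e : ∀ {x} → Touches x e → bypass x ≡ x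
    bypass-e {x} t with touches? x e
    ... | yes _ = refl
    ... | no ¬t = ⊥-elim (¬t t)

    bypass-other : ∀ {x} → ¬ Touches x e → bypass x ≡ α x
    bypass-other {x} ¬t with touches? x e
    ... | yes t = ⊥-elim (¬t t)
    ... | no _  = refl

-- Plane embeddings and the contraction of an edge.

walk-constant : ∀ {n V k} {α : Fin n → Fin n} {lab : Fin n → Fin V} {ok : Fin V → Set} (c : Fin n → Fin k) →
                (∀ x → c (α x) ≡ c x) → (∀ x y → lab x ≡ lab y → ok (lab x) → c x ≡ c y) →
                ∀ {u v} → Walk α lab ok u v → ∀ x y → lab x ≡ u → lab y ≡ v → c x ≡ c y
walk-constant c α-inv const (Walk.here okay)       x y refl ex = const x y (sym ex) okay
walk-constant c α-inv const (Walk.step d e okay w) x y refl ey =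
  trans (const x d (sym e) okay) (trans (sym (α-inv d)) (walk-constant c α-inv const w _ y refl ey))

module Embedding {n V F : ℕ} (α : Fin n → Fin n) (invol : ∀ d → α (α d) ≡ d) (α-free : ∀ d → α d ≢ d)
                 (σ : Fin n → Fin n) (σ-inj : Inj σ) (lab : Fin n → Fin V) (vertices : OrbitLabelling σ V lab)
                 (flab : Fin n → Fin F) (faces : OrbitLabelling (σ ∘ α) F flab)
                 (gconn : GConnected α lab) (euler : 2 * (V + F) ≡ n + 4) where

  open EdgeList α invol α-free

  connected : ∀ {k} (c : Fin n → Fin k) → (∀ x → c (σ x) ≡ c x) → (∀ x → c (α x) ≡ c x) → ∀ x y → c x ≡ c y
  connected c σ-inv α-inv x y = walk-constant c α-inv
    (λ x y e _ → invariant⇒constant {c = c} σ-inv (OrbitLabelling.sameLab⇒ vertices x y e))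
    (gconn (lab x) (lab y)) x y refl refl

  planar : Planar σ α lab flab
  planar = record
    { σ-inj = σ-inj ; vertices = vertices ; faces = faces ; α = α ; α-free = α-free ; edges = ds
    ; edges-β = λ x → swaps-touched ind (select-covers (allFin n) (∈-allFin x))
    -- Each listed edge accounts for two distinct darts.
    ; euler = ℕ.*-cancelˡ-≤ 2 (begin
        2 * (length ds + 2)        ≡⟨ solve 1 (λ l → con 2 :* (l :+ con 2) := (l :+ l) :+ con 4) refl (length ds) ⟩
        length ds + length ds + 4  ≤⟨ ℕ.+-monoˡ-≤ 4 (independent-length ind) ⟩
        n + 4                      ≡⟨ sym euler ⟩
        2 * (V + F)                ∎)
    ; connected = connected
    }
    where
    open ℕ.≤-Reasoning
    open +-*-Solver
    ds = select (allFin n)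
    ind = select-independent (allFin n)

  module Contraction (e : Fin n) (e-link : lab e ≢ lab (α e)) where

    -- Splices the rotations at the two ends of `e` into one, with `e` and `α e` kept as dummy
    -- darts.
    σ/e : Fin n → Fin n
    σ/e z = σ (transpose e (α e) z)

    -- The swap in `σ/e` and the fixed points of `bypass e` cancel, so contraction leaves the face
    -- permutation literally unchanged.
    σ/e-φ : ∀ x → σ (α x) ≡ σ/e (bypass e x)
    σ/e-φ x = cong σ (cases (touches? x e))
      where
      cases : Dec (Touches x e) → α x ≡ transpose e (α e) (bypass e x)
      cases (yes t@(inj₁ refl)) = sym (trans (cong (transpose e (α e)) (bypass-e e t)) (transpose-fst e (α e)))
      cases (yes t@(inj₂ refl)) = trans (invol e) (sym (trans (cong (transpose e (α e)) (bypass-e e t))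
          (transpose-snd e (α e))))
      cases (no ¬t) = sym (trans (cong (transpose e (α e)) (bypass-other e ¬t))
        (transpose-other e (α e) (λ p → ¬t (touches-α (inj₁ p))) (λ p → ¬t (touches-α (inj₂ p)))))

    contract : ∃[ V′ ] Σ (Fin V → Fin V′) λ g →
               g (lab e) ≡ g (lab (α e)) × Planar σ/e (bypass e) (g ∘ lab) flab
    contract with merge σ-inj vertices {σ e} {σ (α e)} (λ p → e-link
        (trans (sym (lab-step vertices e)) (trans p (lab-step vertices (α e)))))
    ... | V′ , V≡ , g , g≡ , ol = V′ , g , ge , record
      { σ-inj = λ eq → transpose-injective e (α e) (σ-inj eq)
      ; vertices = ol′
      ; faces = labelling-cong σ/e-φ faces
      ; α = α ; α-free = α-free ; edges = ds
      ; edges-β = swaps-bypass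
      -- One vertex and one edge are lost. Since `e` is disjoint from `ds`, its darts still count
      -- towards `n`.
      ; euler = ℕ.+-cancelʳ-≤ 1 _ _ (ℕ.*-cancelˡ-≤ 2 (begin
          2 * (length ds + 2 + 1)                   ≡⟨ solve 1 (λ l → con 2 :* (l :+ con 2 :+ con 1) :=
              (con 1 :+ l :+ (con 1 :+ l)) :+ con 4) refl (length ds) ⟩
          suc (length ds) + suc (length ds) + 4     ≤⟨ ℕ.+-monoˡ-≤ 4 (independent-length (e-free ∷ ind)) ⟩
          n + 4                                     ≡⟨ sym euler ⟩
          2 * (V + F)                               ≡⟨ cong (λ v → 2 * (v + F)) V≡ ⟩
          2 * (suc V′ + F)                          ≡⟨ cong (2 *_) (ℕ.+-comm 1 (V′ + F)) ⟩
          2 * (V′ + F + 1)                          ∎))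
      ; connected = λ c σ-inv β-inv → let
          const : ∀ x y → g (lab x) ≡ g (lab y) → c x ≡ c y
          const x y p = invariant⇒constant {c = c} σ-inv (OrbitLabelling.sameLab⇒ ol′ x y p)
          in connected c (λ x → const _ _ (cong g (lab-step vertices x)))
              (λ x → α-invariant c (const e (α e) ge) β-inv x (touches? x e))
      }
      where
      open ℕ.≤-Reasoning
      open +-*-Solver
      ge : g (lab e) ≡ g (lab (α e))
      ge = trans (cong g (sym (lab-step vertices e))) (trans g≡ (cong g (lab-step vertices (α e))))
      ol′ : OrbitLabelling σ/e V′ (g ∘ lab)
      ol′ = labelling-cong (transpose-natural σ-inj e (α e)) ol
      xs = filter (λ d → ¬? (touches? d e)) (allFin n)
      ds = select xs
      ind = select-independent xs
      e-free′ : ∀ {x} → Touches x e → ¬ Touched x ds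
      e-free′ t tds with All.lookupAny (select-All {λ d → ¬ Touches d e} xs
          (λ m → proj₂ (∈-filter⁻ (λ d → ¬? (touches? d e)) {xs = allFin n} m))) tds
      ... | ¬d , inj₁ p = ¬d (subst (λ z → Touches z e) p t)
      ... | ¬d , inj₂ p = ¬d (touches-α (subst (λ z → Touches z e) p t))
      e-free : ¬ Touched e ds
      e-free = e-free′ (inj₁ refl)
      swaps-bypass : ∀ x → swaps α ds x ≡ bypass e x
      swaps-bypass x with touches? x e
      ... | yes t = swaps-untouched (e-free′ t)
      ... | no ¬t = swaps-touched ind (select-covers xs (∈-filter⁺ (λ d → ¬? (touches? d e)) (∈-allFin x) ¬t))
      α-invariant : ∀ {k} (c : Fin n → Fin k) → c e ≡ c (α e) → (∀ x → c (bypass e x) ≡ c x) → ∀ x → Dec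
          (Touches x e) → c (α x) ≡ c x
      α-invariant c ce β-inv x (yes (inj₁ refl)) = sym ce
      α-invariant c ce β-inv x (yes (inj₂ refl)) = trans (cong c (invol e)) ce
      α-invariant c ce β-inv x (no ¬t) = trans (cong c (sym (bypass-other e ¬t))) (β-inv x)

-- Nonseparability

-- A cut vertex w (or a loop at w) shows up as an edge colouring that is constant around every other vertex.
Nonseparable : ∀ {n V} → (Fin n → Fin n) → (Fin n → Fin V) → Set
Nonseparable {n} {V} α lab =
  ∀ {k} (c : Fin n → Fin k) (w : Fin V) → (∀ x → c (α x) ≡ c x) →
  (∀ x y → lab x ≡ lab y → lab x ≢ w → c x ≡ c y) → ∀ x y → c x ≡ c y

-- In a loopless graph a dart at `w` can be traded for the other end of its edge, which has the same
-- colour; a walk avoiding `w` then joins any two darts.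
2connected⇒nonseparable : ∀ {n V} {α : Fin n → Fin n} {lab : Fin n → Fin V} →
                          GSimple α lab → G2Connected α lab → Nonseparable α lab
2connected⇒nonseparable {n} {α = α} {lab} (loopless , _) (_ , _ , avoid) c w α-inv const x y =
  trans (sym (proj₂ (proj₂ (away x))))
    (trans (walk-constant c α-inv const (avoid w _ _ (proj₁ (proj₂ (away x))) (proj₁ (proj₂ (away y)))) _ _ refl refl)
      (proj₂ (proj₂ (away y))))
  where
  away : ∀ x → ∃[ x′ ] (lab x′ ≢ w × c x′ ≡ c x)
  away x with lab x ≟ w
  ... | no p  = x , p , refl
  ... | yes p = α x , (λ q → loopless x (trans q (sym p))) , α-inv x

step⇒constant : ∀ {n V k} {σ : Fin n → Fin n} {lab : Fin n → Fin V} → OrbitLabelling σ V lab →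
                {c : Fin n → Fin k} {ok : Fin V → Set} → (∀ z → ok (lab z) → c (σ z) ≡ c z) →
                ∀ x y → lab x ≡ lab y → ok (lab x) → c x ≡ c y
step⇒constant {lab = lab} ol {c} {ok} inv x y e okx = sym (proj₂ (walk (λ z → lab x ≡ lab z × c z ≡ c x)
  (λ z _ (p , q) → trans p (sym (lab-step ol z)) , trans (inv z (subst ok p okx)) q)
  (OrbitLabelling.sameLab⇒ ol x y e) (refl , refl)))

-- A colour change at the vertex w forces a face to return to w, and cutting along that face separates the dual.
faces-nonseparable⇒ : ∀ {n V F} {σ β : Fin n → Fin n} {lab : Fin n → Fin V} {flab : Fin n → Fin F} →
  Planar σ β lab flab → (∀ x → β (β x) ≡ x) → (Real : Fin n → Set) →
  (∀ {k} (c : Fin n → Fin k) f → (∀ x → c (β x) ≡ c x) → (∀ x → flab x ≢ f → c (σ (β x)) ≡ c x) →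
     ∀ x y → Real x → Real y → c x ≡ c y) →
  ∀ {k} (c : Fin n → Fin k) w → (∀ x → c (β x) ≡ c x) → (∀ z → lab z ≢ w → c (σ z) ≡ c z) →
  (∀ z → c (σ z) ≢ c z → Real (σ z)) → ∀ x y → c x ≡ c y
faces-nonseparable⇒ {n} {σ = σ} {β} {lab} {flab} P ββ Real nonsep c w β-inv off-w real = connected c σ-inv β-inv
  where
  open Planar P
  φ : Fin n → Fin n
  φ = σ ∘ β
  at-w : ∀ {z} → c (σ z) ≢ c z → lab (σ z) ≡ w
  at-w {z} p = trans (lab-step vertices z) (decidable-stable (lab z ≟ w) (λ q → p (off-w z q)))
  module _ (z : Fin n) (change : c (σ z) ≢ c z) where
    x = β z
    X = σ z
    φx≡X : φ x ≡ X
    φx≡X = cong σ (ββ z)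
    -- A second colour change on this face would give two corners of `w`, `X` and `φ u`, on one
    -- face. The colouring from `jordan` separates them, but as a colouring of the dual it changes
    -- at that face only, against `nonsep`.
    no-change : ∀ u → u ≢ x → flab u ≡ flab X → c (φ u) ≡ c u
    no-change u u≢x fu with c (φ u) ≟ c u
    ... | yes p = p
    ... | no p = ⊥-elim (differ (nonsep c′ (flab X) β-inv′ off-f X (φ u) (real z change) (real (β u) change′)))
      where
      change′ : c (φ u) ≢ c (β u)
      change′ q = p (trans q (β-inv u))
      X≢Y : X ≢ φ u
      X≢Y q = u≢x (φ-inj (trans (sym q) (sym φx≡X)))
      J = jordan P X≢Y (trans (at-w change) (sym (at-w change′))) (trans (sym fu) (sym (lab-step faces u)))
      c′ = proj₁ (proj₂ J)
      differ = proj₁ (proj₂ (proj₂ J))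
      σ~-inv = proj₁ (proj₂ (proj₂ (proj₂ J)))
      β-inv′ = proj₂ (proj₂ (proj₂ (proj₂ J)))
      off-f : ∀ v → flab v ≢ flab X → c′ (φ v) ≡ c′ v
      off-f v fv = trans (sym (cong c′ (transpose-other X (φ u)
          (λ q → fv (trans (sym (lab-step faces v)) (cong flab q)))
          (λ q → fv (trans (sym (lab-step faces v)) (trans (cong flab q) (trans (lab-step faces u) fu)))))))
        (trans (σ~-inv (β v)) (β-inv′ v))
    -- So the colour persists from `X` all the way round the face to `x = β z`, whose colour is that
    -- of `z`.
    around : flab x ≡ flab X × c x ≡ c X
    around = walk (λ u → flab u ≡ flab X × c u ≡ c X)
      (λ u u≢x (p , q) → trans (lab-step faces u) p , trans (no-change u u≢x p) q)
      (orbit-return φ-inj x) (cong flab φx≡X , cong c φx≡X)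
    absurd : ⊥
    absurd = change (trans (sym (proj₂ around)) (β-inv z))
  σ-inv : ∀ z → c (σ z) ≡ c z
  σ-inv z = decidable-stable (c (σ z) ≟ c z) (absurd z)

module Nonsep {n V : ℕ} {α : Fin n → Fin n} (invol : ∀ d → α (α d) ≡ d) (α-free : ∀ d → α d ≢ d)
              {lab : Fin n → Fin V} (nonsep : Nonseparable α lab) where

  open EdgeList α invol α-free

  module _ (another : ∀ d → ∃[ x ] ¬ Touches x d) where

    private
      mark : Fin n → Fin n → Fin 2
      mark d x with touches? x d
      ... | yes _ = suc zero
      ... | no  _ = zero
      mark-on : ∀ {d x} → Touches x d → mark d x ≡ suc zero
      mark-on {d} {x} t with touches? x d
      ... | yes _ = refl
      ... | no ¬t = ⊥-elim (¬t t)
      mark-off : ∀ {d x} → ¬ Touches x d → mark d x ≡ zero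
      mark-off {d} {x} ¬t with touches? x d
      ... | yes t = ⊥-elim (¬t t)
      ... | no _  = refl
      mark-α : ∀ d x → mark d (α x) ≡ mark d x
      mark-α d x = cases (touches? x d)
        where
        cases : Dec (Touches x d) → mark d (α x) ≡ mark d x
        cases (yes t) = trans (mark-on (touches-α (subst (λ z → Touches z d) (sym (invol x)) t))) (sym (mark-on t))
        cases (no ¬t) = trans (mark-off (¬t ∘ touches-α)) (sym (mark-off ¬t))
      -- One edge as a colour class of its own. It must not meet the other edges in a single vertex
      -- `w` only, as a loop or a pendant edge would.
      lone : ∀ d w → (∀ x y → lab x ≡ lab y → lab x ≢ w → mark d x ≡ mark d y) → ⊥
      lone d w const with another d
      ... | x , ¬t with trans (sym (mark-off ¬t)) (trans (nonsep (mark d) w (mark-α d) const x d) (mark-on (inj₁ refl)))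
      ... | ()

    loopless : ∀ d → lab d ≢ lab (α d)
    loopless d e = lone d (lab d) λ x y exy off → trans (mark-off (off-d off))
        (sym (mark-off (off-d (λ q → off (trans exy q)))))
      where
      off-d : ∀ {x} → lab x ≢ lab d → ¬ Touches x d
      off-d off (inj₁ refl) = off refl
      off-d off (inj₂ refl) = off (sym e)

    no-pendant : ∀ {σ} → OrbitLabelling σ V lab → ∀ d → σ d ≢ d
    no-pendant {σ} ol d fix = lone d (lab (α d)) λ x y exy off → cases x y exy off (touches? x d) (touches? y d)
      where
      alone : ∀ x → lab d ≡ lab x → x ≡ d
      alone x e = walk (λ z → z ≡ d) (λ { z _ refl → fix }) (OrbitLabelling.sameLab⇒ ol d x e) refl
      cases : ∀ x y → lab x ≡ lab y → lab x ≢ lab (α d) → Dec (Touches x d) → Dec (Touches y d) → mark d x ≡ mark d y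
      cases x y e off (yes (inj₁ refl)) _ = cong (mark d) (sym (alone y e))
      cases x y e off (yes (inj₂ refl)) _ = ⊥-elim (off refl)
      cases x y e off (no _) (yes (inj₁ refl)) = cong (mark d) (alone x (sym e))
      cases x y e off (no _) (yes (inj₂ refl)) = ⊥-elim (off e)
      cases x y e off (no p) (no q) = trans (mark-off p) (sym (mark-off q))

-- Hamiltonian cycles of outerplanar graphs

module Hamiltonian {n V F : ℕ} (α : Fin n → Fin n) (invol : ∀ d → α (α d) ≡ d) (α-free : ∀ d → α d ≢ d)
                   (σ : Fin n → Fin n) (σ-inj : Inj σ) (lab : Fin n → Fin V) (vertices : OrbitLabelling σ V lab)
                   (flab : Fin n → Fin F) (faces : OrbitLabelling (σ ∘ α) F flab)
                   (gconn : GConnected α lab) (euler : 2 * (V + F) ≡ n + 4)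
                   (nonsep : Nonseparable α lab)
                   (another : ∀ d → ∃[ x ] ¬ EdgeList.Touches α invol α-free x d)
                   (f₀ : Fin F) (outer : ∀ v → ∃[ d ] (lab d ≡ v × flab d ≡ f₀)) where

  open EdgeList α invol α-free
  open Embedding α invol α-free σ σ-inj lab vertices flab faces gconn euler
  open Nonsep invol α-free nonsep

  φ : Fin n → Fin n
  φ = σ ∘ α

  o : Fin V → Fin n
  o v = proj₁ (outer v)

  Outer : Fin n → Set
  Outer x = flab x ≡ f₀

  lab-o : ∀ v → lab (o v) ≡ v
  lab-o v = proj₁ (proj₂ (outer v))

  o-outer : ∀ v → Outer (o v)
  o-outer v = proj₂ (proj₂ (outer v))

  -- If the outer face had two corners at one vertex, the Jordan curve through them would show that
  -- vertex to be a cut vertex.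
  outer-unique : ∀ x y → Outer x → Outer y → lab x ≡ lab y → x ≡ y
  outer-unique x y Ox Oy e with x ≟ y
  ... | yes p = p
  ... | no p with jordan planar p e (trans Ox (sym Oy))
  ... | k , c , differ , σ~-inv , α-inv = ⊥-elim (differ (nonsep c (lab x) α-inv
        (step⇒constant vertices {c} {_≢ lab x} (λ z z≢ → trans (sym (cong c (transpose-other x y
          (λ q → z≢ (trans (sym (lab-step vertices z)) (cong lab q)))
          (λ q → z≢ (trans (sym (lab-step vertices z)) (trans (cong lab q) (sym e))))))) (σ~-inv z))) x y))

  outer≡o : ∀ {x} → Outer x → x ≡ o (lab x)
  outer≡o {x} Ox = outer-unique x _ Ox (o-outer _) (sym (lab-o _))

  next : Fin V → Fin V
  next v = lab (α (o v))

  φ-o : ∀ v → φ (o v) ≡ o (next v)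
  φ-o v = trans (outer≡o (trans (lab-step faces (o v)) (o-outer v))) (cong o (lab-step vertices _))

  -- Otherwise `α x` and `σ (α x)` are outer darts at one vertex, hence equal, and the edge is
  -- pendant.
  outer-α : ∀ {x} → Outer x → ¬ Outer (α x)
  outer-α {x} Ox Oαx = no-pendant another vertices (α x)
    (outer-unique _ _ (trans (lab-step faces x) Ox) Oαx (lab-step vertices (α x)))

  -- The outer face is one orbit of `φ` and meets each vertex in exactly one dart, so `next` traces
  -- a Hamiltonian cycle.
  next-orbit : ∀ u v → SameOrbit next u v
  next-orbit u v with OrbitLabelling.sameLab⇒ faces (o u) (o v) (trans (o-outer u) (sym (o-outer v)))
  ... | k , eq = k , trans (sym (lab-o _)) (trans (cong lab (trans (sym (go k)) eq)) (lab-o v))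
    where
    go : ∀ k → iter φ k (o u) ≡ o (iter next k u)
    go zero    = refl
    go (suc k) = trans (cong φ (go k)) (φ-o _)

  next-injective : Inj next
  next-injective {u} {v} e = trans (sym (lab-o u)) (trans (cong lab
      (α-inj (σ-inj (trans (φ-o u) (trans (cong o e) (sym (φ-o v))))))) (lab-o v))

  -- Contracting e makes the outer face pass twice through the merged vertex.
  arcs : ∀ e → Σ ℕ λ k → Σ (Fin n → Fin k) λ c →
         c (o (lab e)) ≢ c (o (lab (α e))) ×
         (∀ x → ¬ Touches x e → c (α x) ≡ c x) ×
         (∀ x y → lab x ≡ lab y → lab x ≢ lab e × lab x ≢ lab (α e) → c x ≡ c y)
  arcs e with Contraction.contract e (loopless another e)
  ... | V′ , g , g≡ , P
    with jordan P {o (lab e)} {o (lab (α e))}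
           (λ q → loopless another e (trans (sym (lab-o _)) (trans (cong lab q) (lab-o _))))
           (trans (cong g (lab-o _)) (trans g≡ (cong g (sym (lab-o _)))))
           (trans (o-outer _) (sym (o-outer _)))
  ... | k , c , differ , σ~-inv , β-inv = k , c , differ ,
        (λ x ¬t → trans (sym (cong c (bypass-other e ¬t))) (β-inv x)) ,
        step⇒constant vertices {c} {λ v → v ≢ lab e × v ≢ lab (α e)} (λ z (z≢e , z≢αe) →
          trans (sym (cong c (away z z≢e z≢αe))) (σ~-inv z))
    where
    open Contraction e (loopless another e)
    off : ∀ {z v} → lab z ≢ v → σ z ≢ o v
    off {z} z≢v q = z≢v (trans (sym (lab-step vertices z)) (trans (cong lab q) (lab-o _)))
    away : ∀ z → lab z ≢ lab e → lab z ≢ lab (α e) → transpose (o (lab e)) (o (lab (α e))) (σ/e z) ≡ σ z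
    away z z≢e z≢αe = trans
      (cong (transpose (o (lab e)) (o (lab (α e)))) (cong σ (transpose-other e (α e) (z≢e ∘ cong lab)
          (z≢αe ∘ cong lab))))
      (transpose-other _ _ (off z≢e) (off z≢αe))

permutation-injective : ∀ {n} (π : Permutation′ n) → Inj (π ⟨$⟩ʳ_)
permutation-injective π eq = trans (sym (Perm.inverseˡ π)) (trans (cong (π ⟨$⟩ˡ_) eq) (Perm.inverseˡ π))

outerplanar-connected : ∀ {n V} {α : Fin n → Fin n} {lab : Fin n → Fin V} → Outerplanar α lab → GConnected α lab
outerplanar-connected (_ , _ , _ , _ , _ , conn , _) = conn

-- The cycle comes from the embedding that witnesses outerplanarity. Its rotation may differ from
-- that of the given map; the two share darts, edges and vertices.
module OuterplanarCycle {n V : ℕ} (α : Fin n → Fin n) (invol : ∀ d → α (α d) ≡ d) (α-free : ∀ d → α d ≢ d)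
                        (lab : Fin n → Fin V) (nonsep : Nonseparable α lab)
                        (another : ∀ d → ∃[ x ] ¬ EdgeList.Touches α invol α-free x d)
                        (outerplanar : Outerplanar α lab) where

  private
    σ′ = proj₁ outerplanar
    flab = proj₁ (proj₂ (proj₂ outerplanar))
    vertices = proj₁ (proj₂ (proj₂ (proj₂ outerplanar)))
    faces = proj₁ (proj₂ (proj₂ (proj₂ (proj₂ outerplanar))))
    euler = proj₁ (proj₂ (proj₂ (proj₂ (proj₂ (proj₂ (proj₂ outerplanar))))))
    outer-face = proj₂ (proj₂ (proj₂ (proj₂ (proj₂ (proj₂ (proj₂ outerplanar))))))

  open Hamiltonian α invol α-free (σ′ ⟨$⟩ʳ_) (permutation-injective σ′) lab vertices flab faces
    (outerplanar-connected outerplanar) euler nonsep another (proj₁ outer-face) (proj₂ outer-face) public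

third : ∀ {n} → 3 ≤ n → (a b : Fin n) → ∃[ c ] (c ≢ a × c ≢ b)
third (s≤s (s≤s (s≤s _))) zero          zero          = suc zero , (λ ()) , λ ()
third (s≤s (s≤s (s≤s _))) zero          (suc zero)    = suc (suc zero) , (λ ()) , λ ()
third (s≤s (s≤s (s≤s _))) zero          (suc (suc _)) = suc zero , (λ ()) , λ ()
third (s≤s (s≤s (s≤s _))) (suc zero)    zero          = suc (suc zero) , (λ ()) , λ ()
third (s≤s (s≤s (s≤s _))) (suc (suc _)) zero          = suc zero , (λ ()) , λ ()
third (s≤s (s≤s (s≤s _))) (suc _)       (suc _)       = zero , (λ ()) , λ ()

-- Counting

open Sum ℕ.+-0-commutativeMonoid using (sum; sum-cong-≗; sum-replicate-zero; ∑-distrib-+; ∑-comm; sum-permute)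

⟦_⟧ : {P : Set} → Dec P → ℕ
⟦ d ⟧ = if does d then 1 else 0

⟦⟧-yes : {P : Set} (d : Dec P) → P → ⟦ d ⟧ ≡ 1
⟦⟧-yes (yes _) _ = refl
⟦⟧-yes (no ¬p) p = ⊥-elim (¬p p)

⟦⟧-no : {P : Set} (d : Dec P) → ¬ P → ⟦ d ⟧ ≡ 0
⟦⟧-no (yes p) ¬p = ⊥-elim (¬p p)
⟦⟧-no (no _)  _  = refl

sum-const : ∀ n → sum {n} (λ _ → 1) ≡ n
sum-const zero    = refl
sum-const (suc n) = cong suc (sum-const n)

sum-delta : ∀ {n} (a : Fin n) (h : Fin n → ℕ) → sum (λ x → ⟦ x ≟ a ⟧ * h x) ≡ h a
sum-delta {suc n} zero    h = trans (cong₂ _+_ (ℕ.+-identityʳ (h zero)) (sum-replicate-zero n)) (ℕ.+-identityʳ (h zero))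
sum-delta {suc n} (suc a) h = sum-delta a (h ∘ suc)

-- Double counting of pairs of a dart and its label: `o` is a bijection from the labels onto the
-- darts in `P`.
sum-section : ∀ {n V} {P : Fin n → Set} (P? : Decidable P) (o : Fin V → Fin n) (lab : Fin n → Fin V) →
              (∀ v → P (o v)) → (∀ v → lab (o v) ≡ v) → (∀ {x} → P x → x ≡ o (lab x)) →
              ∀ (h : Fin n → ℕ) → sum (λ x → ⟦ P? x ⟧ * h x) ≡ sum (h ∘ o)
sum-section {P = P} P? o lab Po lab-o P≡o h = begin
  sum (λ x → ⟦ P? x ⟧ * h x)                                ≡⟨ sum-cong-≗
      (λ x → sym (sum-delta (lab x) (λ _ → ⟦ P? x ⟧ * h x))) ⟩
  sum (λ x → sum (λ v → ⟦ v ≟ lab x ⟧ * (⟦ P? x ⟧ * h x)))  ≡⟨ ∑-comm (λ x v → ⟦ v ≟ lab x ⟧ * (⟦ P? x ⟧ * h x)) ⟩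
  sum (λ v → sum (λ x → ⟦ v ≟ lab x ⟧ * (⟦ P? x ⟧ * h x)))  ≡⟨ sum-cong-≗
      (λ v → sum-cong-≗ (λ x → term v x (v ≟ lab x) (P? x) (x ≟ o v))) ⟩
  sum (λ v → sum (λ x → ⟦ x ≟ o v ⟧ * h x))                 ≡⟨ sum-cong-≗ (λ v → sum-delta (o v) h) ⟩
  sum (h ∘ o)                                               ∎
  where
  open ≡-Reasoning
  term : ∀ v x (p : Dec (v ≡ lab x)) (q : Dec (P x)) (r : Dec (x ≡ o v)) → ⟦ p ⟧ * (⟦ q ⟧ * h x) ≡ ⟦ r ⟧ * h x
  term v x (yes p) (yes q) (yes r) = ℕ.*-identityˡ _
  term v x (yes p) (yes q) (no ¬r) = ⊥-elim (¬r (trans (P≡o q) (cong o (sym p))))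
  term v x (yes p) (no ¬q) (yes refl) = ⊥-elim (¬q (Po v))
  term v x (yes p) (no ¬q) (no ¬r) = refl
  term v x (no ¬p) q (yes refl) = ⊥-elim (¬p (sym (lab-o v)))
  term v x (no ¬p) q (no ¬r) = refl

sum≡1 : ∀ {n} (h : Fin n → ℕ) → sum h ≡ 1 → ∃[ i ] h i ≡ 1
sum≡1 {suc n} h eq with h zero in h₀
... | suc zero = zero , h₀
... | zero with sum≡1 (h ∘ suc) eq
... | i , hi = suc i , hi

sum≡2 : ∀ {n} (h : Fin n → ℕ) → (∀ i → h i ≤ 1) → sum h ≡ 2 → ∃[ i ] ∃[ j ] (i ≢ j × h i ≡ 1 × h j ≡ 1)
sum≡2 {suc n} h h≤1 eq with h zero in h₀
... | suc (suc _) = ⊥-elim (ℕ.1+n≰n (ℕ.≤-trans (s≤s (s≤s z≤n)) (subst (_≤ 1) h₀ (h≤1 zero))))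
... | suc zero with sum≡1 (h ∘ suc) (ℕ.suc-injective eq)
...   | i , hi = zero , suc i , (λ ()) , h₀ , hi
sum≡2 {suc n} h h≤1 eq | zero with sum≡2 (h ∘ suc) (h≤1 ∘ suc) eq
...   | i , j , i≢j , hi , hj = suc i , suc j , i≢j ∘ suc-injective , hi , hj

-- The two Hamiltonian cycles and the edges they share.

module Main (M : PlanarMap) (simple : Simple M) (2conn : TwoConnected M)
            (outerplanar : WeaklyOuterplanar M) (dualOuterplanar : DualWeaklyOuterplanar M) where

  open PlanarMap M
  open EdgeList α α-invol α-free public

  σf φ : Fin nD → Fin nD
  σf = σ ⟨$⟩ʳ_
  φ x = σf (α x)

  σ-inj : Inj σf
  σ-inj = permutation-injective σ

  φ-inj : Inj φ
  φ-inj = α-inj ∘ σ-inj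

  abstract
    another : ∀ d → ∃[ x ] ¬ Touches x d
    another d =
      let w , w≢ , w≢α = third (proj₁ 2conn) (vtx d) (vtx (α d))
          x , x≡ = OrbitLabelling.surj vtx-orbits w
      in x , [ (λ p → w≢ (trans (sym x≡) (cong vtx p))) , (λ p → w≢α (trans (sym x≡) (cong vtx p))) ]′

    nonsepV : Nonseparable α vtx
    nonsepV = 2connected⇒nonseparable simple 2conn

  module E = Embedding α α-invol α-free σf σ-inj vtx vtx-orbits fc fc-orbits connected euler

  φα≡σ : ∀ x → σf x ≡ φ (α x)
  φα≡σ x = cong σf (sym (α-invol x))

  dualConnected : GConnected α fc
  dualConnected = outerplanar-connected dualOuterplanar

  -- The dual map has rotation `φ`, and `φ ∘ α` is `σ` again, so its faces are the vertices of `M`.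
  module E* = Embedding α α-invol α-free φ φ-inj fc fc-orbits vtx (labelling-cong φα≡σ vtx-orbits) dualConnected
                (trans (cong (2 *_) (ℕ.+-comm nF nV)) euler)

  abstract
    -- `faces-nonseparable⇒` applied to the dual map, whose own dual `M` is nonseparable; all darts
    -- are real here.
    nonsepF : Nonseparable α fc
    nonsepF c w α-inv const = faces-nonseparable⇒ E*.planar α-invol (λ _ → ⊤)
      (λ c v α-inv off x y _ _ → nonsepV c v α-inv
        (step⇒constant vtx-orbits {c} {_≢ v} (λ z z≢ → trans (cong c (φα≡σ z)) (off z z≢))) x y)
      c w α-inv (λ z z≢ → sym (const z (φ z) (sym (lab-step fc-orbits z)) z≢)) (λ _ _ → tt)

  open Nonsep α-invol α-free nonsepV using () renaming (loopless to looplessV′; no-pendant to no-pendantV′)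
  open Nonsep α-invol α-free nonsepF using () renaming (loopless to looplessF′)

  abstract
    looplessV : ∀ d → vtx d ≢ vtx (α d)
    looplessV = looplessV′ another
    looplessF : ∀ d → fc d ≢ fc (α d)
    looplessF = looplessF′ another
    σ-moves : ∀ d → σf d ≢ d
    σ-moves = no-pendantV′ another vtx-orbits

  module C = OuterplanarCycle α α-invol α-free vtx nonsepV another outerplanar
  module C* = OuterplanarCycle α α-invol α-free fc nonsepF another dualOuterplanar

  -- The edge of `x` lies on the primal cycle, respectively on the dual cycle; the cycle may
  -- traverse it by either of its darts.
  Cyclic Crossing : Fin nD → Set
  Cyclic x   = C.Outer x ⊎ C.Outer (α x)
  Crossing x = C*.Outer x ⊎ C*.Outer (α x)

  outer? : Decidable C.Outer
  outer? x = _ ≟ _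
  outer*? : Decidable C*.Outer
  outer*? x = _ ≟ _

  crossing? : Decidable Crossing
  crossing? x = outer*? x ⊎-dec outer*? (α x)

  crossing-α : ∀ {x} → Crossing x → Crossing (α x)
  crossing-α {x} (inj₁ p) = inj₂ (subst C*.Outer (sym (α-invol x)) p)
  crossing-α (inj₂ p) = inj₁ p

  touches-crossing : ∀ {x e} → Touches x e → Crossing x → Crossing e
  touches-crossing (inj₁ refl) p = p
  touches-crossing {e = e} (inj₂ refl) p = subst Crossing (α-invol e) (crossing-α p)

  -- An edge e outside both Hamiltonian cycles: contracting e separates the graph, but the dual cycle avoids e.
  module _ (e : Fin nD) (¬cyc : ¬ Cyclic e) (¬cross : ¬ Crossing e) where

    open E.Contraction e (looplessV e)

    private
      bypass-involutive : ∀ x → bypass e (bypass e x) ≡ x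
      bypass-involutive x = cases (touches? x e)
        where
        cases : Dec (Touches x e) → bypass e (bypass e x) ≡ x
        cases (yes t) = trans (cong (bypass e) (bypass-e e t)) (bypass-e e t)
        cases (no ¬t) = trans (cong (bypass e) (bypass-other e ¬t)) (trans (bypass-other e (¬t ∘ touches-α))
            (α-invol x))

      real-o* : ∀ v → ¬ Touches (C*.o v) e
      real-o* v t = ¬cross (touches-crossing t (inj₁ (C*.o-outer v)))

      -- Contracting `e` deletes it from the dual. The dual cycle avoids `e`, so without `f` it is a
      -- path through all other faces, along which the colour stays `κ`, the colour found right
      -- after `f`.
      nonsep/e : ∀ {k} (c : Fin nD → Fin k) f → (∀ x → c (bypass e x) ≡ c x) →
                 (∀ x → fc x ≢ f → c (σ/e (bypass e x)) ≡ c x) →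
                 ∀ x y → ¬ Touches x e → ¬ Touches y e → c x ≡ c y
      nonsep/e c f β-inv off x y ¬tx ¬ty = trans (all x ¬tx) (sym (all y ¬ty))
        where
        κ = c (α (C*.o f))
        const : ∀ x y → fc x ≡ fc y → fc x ≢ f → c x ≡ c y
        const = step⇒constant fc-orbits {c} {_≢ f} (λ z z≢ → trans (cong c (σ/e-φ z)) (off z z≢))
        α-inv : ∀ x → ¬ Touches x e → c (α x) ≡ c x
        α-inv x ¬t = trans (cong c (sym (bypass-other e ¬t))) (β-inv x)
        on-cycle : ∀ v → v ≢ f → c (C*.o v) ≡ κ
        on-cycle v = walk (λ v → v ≢ f → c (C*.o v) ≡ κ) advance (C*.next-orbit f v) (λ p → ⊥-elim (p refl))
          where
          advance : ∀ u → u ≢ v → (u ≢ f → c (C*.o u) ≡ κ) → C*.next u ≢ f → c (C*.o (C*.next u)) ≡ κ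
          advance u _ ih p with u ≟ f
          ... | yes refl = const _ _ (C*.lab-o _) (λ q → p (trans (sym (C*.lab-o _)) q))
          ... | no q = trans (const _ _ (C*.lab-o _) (λ r → p (trans (sym (C*.lab-o _)) r)))
                         (trans (α-inv _ (real-o* u)) (ih q))
        off-f : ∀ x → fc x ≢ f → c x ≡ κ
        off-f x p = trans (const x _ (sym (C*.lab-o _)) p) (on-cycle _ p)
        all : ∀ x → ¬ Touches x e → c x ≡ κ
        all x ¬t with fc x ≟ f
        ... | no p  = off-f x p
        -- The other side of a dart of `f` is a different face, as the dual has no loops.
        ... | yes p = trans (sym (α-inv x ¬t)) (off-f (α x) (λ q → looplessF x (trans p (sym q))))

      pre : Fin nD → Fin nD
      pre = σ ⟨$⟩ˡ_

      σ-pre : ∀ x → σf (pre x) ≡ x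
      σ-pre x = Perm.inverseʳ σ

      pre-real : ∀ {t} → Touches t e → ¬ Touches (pre t) e
      pre-real {t} tt′ s = cases tt′ s
        where
        vtx-pre : vtx (pre t) ≡ vtx t
        vtx-pre = trans (sym (lab-step vtx-orbits (pre t))) (cong vtx (σ-pre t))
        cases : Touches t e → Touches (pre t) e → ⊥
        cases (inj₁ refl) (inj₁ p) = σ-moves e (trans (cong σf (sym p)) (σ-pre e))
        cases (inj₁ refl) (inj₂ p) = looplessV e (trans (sym vtx-pre) (cong vtx p))
        cases (inj₂ refl) (inj₁ p) = looplessV e (trans (cong vtx (sym p)) vtx-pre)
        cases (inj₂ refl) (inj₂ p) = σ-moves (α e) (trans (cong σf (sym p)) (σ-pre (α e)))

      -- The swap in `σ/e` moves only `e` and `α e`, and by `pre-real` neither is `pre t`; so a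
      -- dummy dart keeps its predecessor.
      enters : ∀ {z t} → Touches t e → σ/e z ≡ t → z ≡ pre t
      enters {z} {t} tt′ p = trans (sym (transpose-inverse (α e) e))
        (trans (cong (transpose (α e) e) q)
          (transpose-other (α e) e (λ r → pre-real tt′ (inj₂ r)) (λ r → pre-real tt′ (inj₁ r))))
        where
        q : transpose e (α e) z ≡ pre t
        q = σ-inj (trans p (sym (σ-pre t)))

    -- Extended to the dummy darts, the colouring of the two arcs changes only at the merged vertex,
    -- so `faces-nonseparable⇒` makes it constant.
    separation-absurd : ∀ {V′ k} (g : Fin nV → Fin V′) → g (vtx e) ≡ g (vtx (α e)) → Planar σ/e (bypass e)
        (g ∘ vtx) fc →
      (c : Fin nD → Fin k) → c (C.o (vtx e)) ≢ c (C.o (vtx (α e))) →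
      (∀ x → ¬ Touches x e → c (α x) ≡ c x) →
      (∀ x y → vtx x ≡ vtx y → vtx x ≢ vtx e × vtx x ≢ vtx (α e) → c x ≡ c y) → ⊥
    separation-absurd {k = k} g g≡ P c differ α-inv const =
      differ (trans (sym (c₂-real (real-o (vtx e)))) (trans
        (faces-nonseparable⇒ P bypass-involutive (λ x → ¬ Touches x e) nonsep/e c₂ (g (vtx e)) β-inv₂ off-w real
          (C.o (vtx e)) (C.o (vtx (α e))))
        (c₂-real (real-o (vtx (α e))))))
      where
      -- The two ends of e stay behind as dummy darts; giving each the colour of its predecessor
      -- keeps colour changes away from them.
      c₂ : Fin nD → Fin k
      c₂ x with touches? x e
      ... | yes _ = c (pre x)
      ... | no  _ = c x
      c₂-real : ∀ {x} → ¬ Touches x e → c₂ x ≡ c x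
      c₂-real {x} ¬t with touches? x e
      ... | yes t = ⊥-elim (¬t t)
      ... | no _  = refl
      c₂-dummy : ∀ {x} → Touches x e → c₂ x ≡ c (pre x)
      c₂-dummy {x} t with touches? x e
      ... | yes _ = refl
      ... | no ¬t = ⊥-elim (¬t t)
      real-o : ∀ v → ¬ Touches (C.o v) e
      real-o v (inj₁ refl) = ¬cyc (inj₁ (C.o-outer v))
      real-o v (inj₂ p) = ¬cyc (inj₂ (subst C.Outer p (C.o-outer v)))
      β-inv₂ : ∀ x → c₂ (bypass e x) ≡ c₂ x
      β-inv₂ x = cases (touches? x e)
        where
        cases : Dec (Touches x e) → c₂ (bypass e x) ≡ c₂ x
        cases (yes t) = cong c₂ (bypass-e e t)
        cases (no ¬t) = trans (cong c₂ (bypass-other e ¬t))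
          (trans (c₂-real (¬t ∘ touches-α)) (trans (α-inv x ¬t) (sym (c₂-real ¬t))))
      off-w : ∀ z → g (vtx z) ≢ g (vtx e) → c₂ (σ/e z) ≡ c₂ z
      off-w z p = trans (cong c₂ (cong σf (transpose-other e (α e) (z≢e ∘ cong vtx) (z≢αe ∘ cong vtx))))
        (trans (c₂-real (away (σf z) (lab-step vtx-orbits z)))
          (trans (const (σf z) z (lab-step vtx-orbits z)
                   (z≢e ∘ trans (sym (lab-step vtx-orbits z)) , z≢αe ∘ trans (sym (lab-step vtx-orbits z))))
            (sym (c₂-real (away z refl)))))
        where
        z≢e : vtx z ≢ vtx e
        z≢e q = p (cong g q)
        z≢αe : vtx z ≢ vtx (α e)
        z≢αe q = p (trans (cong g q) (sym g≡))
        away : ∀ y → vtx y ≡ vtx z → ¬ Touches y e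
        away y q (inj₁ refl) = z≢e (sym q)
        away y q (inj₂ refl) = z≢αe (sym q)
      real : ∀ z → c₂ (σ/e z) ≢ c₂ z → ¬ Touches (σ/e z) e
      real z change t = change (trans (c₂-dummy t)
        (trans (sym (c₂-real (pre-real t))) (cong c₂ (sym (enters {z} t refl)))))

    cover-absurd : ⊥
    cover-absurd =
      let _ , g , g≡ , P = contract
          _ , c , differ , α-inv , const = C.arcs e
      in separation-absurd g g≡ P c differ α-inv const

  covered : ∀ x → ¬ Crossing x → Cyclic x
  covered x ¬cross = decidable-stable (outer? x ⊎-dec outer? (α x)) (λ ¬cyc → cover-absurd x ¬cyc ¬cross)

  module _ where
    private
      -- `a` and `b` mark the darts traversed by the two cycles. By `outer-α` no edge is traversed
      -- in both directions, so `I` and `J` are indicators of the edges on them.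
      a b I J : Fin nD → ℕ
      a x = ⟦ outer? x ⟧
      b x = ⟦ outer*? x ⟧
      I x = a x + a (α x)
      J x = b x + b (α x)

      α-perm : Permutation′ nD
      α-perm = Perm.permutation α α α-invol α-invol

      sum-α : ∀ h → sum (h ∘ α) ≡ sum h
      sum-α h = sym (sum-permute h α-perm)

      sum-double : ∀ h → sum (λ x → h x + h (α x)) ≡ 2 * sum h
      sum-double h = trans (∑-distrib-+ h (h ∘ α)) (cong (sum h +_) (trans (sum-α h) (sym (ℕ.+-identityʳ _))))

      sum-a : ∀ h → sum (λ x → a x * h x) ≡ sum (h ∘ C.o)
      sum-a = sum-section outer? C.o vtx C.o-outer C.lab-o C.outer≡o

      count-a : sum a ≡ nV
      count-a = trans (sum-cong-≗ (λ x → sym (ℕ.*-identityʳ (a x)))) (trans (sum-a (λ _ → 1)) (sum-const nV))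

      count-b : sum b ≡ nF
      count-b = trans (sum-cong-≗ (λ x → sym (ℕ.*-identityʳ (b x))))
        (trans (sum-section outer*? C*.o fc C*.o-outer C*.lab-o C*.outer≡o (λ _ → 1)) (sum-const nF))

      J-α : ∀ x → J (α x) ≡ J x
      J-α x = trans (cong (λ y → b (α x) + b y) (α-invol x)) (ℕ.+-comm (b (α x)) (b x))

      J-crossing : ∀ x → J x ≡ ⟦ crossing? x ⟧
      J-crossing x with outer*? x | outer*? (α x)
      ... | yes p | yes q = ⊥-elim (C*.outer-α p q)
      ... | yes p | no q  = refl
      ... | no p  | yes q = refl
      ... | no p  | no q  = refl

      -- This is `(1 - I x) * (1 - J x) = 0`, which holds because every edge lies on one of the
      -- cycles.
      incl-excl : ∀ x → I x + J x ≡ 1 + I x * J x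
      incl-excl x = trans (cong (I x +_) (J-crossing x))
        (trans (go (outer? x) (outer? (α x)) (crossing? x)) (cong (λ j → 1 + I x * j) (sym (J-crossing x))))
        where
        go : (p : Dec (C.Outer x)) (q : Dec (C.Outer (α x))) (r : Dec (Crossing x)) →
             ⟦ p ⟧ + ⟦ q ⟧ + ⟦ r ⟧ ≡ 1 + (⟦ p ⟧ + ⟦ q ⟧) * ⟦ r ⟧
        go (yes p) (yes q) _ = ⊥-elim (C.outer-α p q)
        go (yes p) (no q) (yes r) = refl
        go (yes p) (no q) (no r) = refl
        go (no p) (yes q) (yes r) = refl
        go (no p) (yes q) (no r) = refl
        go (no p) (no q) (yes r) = refl
        go (no p) (no q) (no r) = ⊥-elim ([ p , q ]′ (covered x r))

      -- The number of edges on both cycles.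
      K = sum (J ∘ C.o)

      sum-IJ : sum (λ x → I x * J x) ≡ 2 * K
      sum-IJ = begin
        sum (λ x → I x * J x)                         ≡⟨ sum-cong-≗
            (λ x → trans (ℕ.*-distribʳ-+ (J x) (a x) (a (α x))) (cong (λ j → a x * J x + a (α x) * j) (sym (J-α x)))) ⟩
        sum (λ x → a x * J x + a (α x) * J (α x))     ≡⟨ sum-double (λ x → a x * J x) ⟩
        2 * sum (λ x → a x * J x)                     ≡⟨ cong (2 *_) (sum-a J) ⟩
        2 * K                                         ∎
        where open ≡-Reasoning

      -- Summing `incl-excl` over all darts gives `2 * nV + 2 * nF = nD + 2 * K`, to be compared
      -- with Euler's formula.
      K≡2 : K ≡ 2
      K≡2 = ℕ.*-cancelˡ-≡ K 2 2 (ℕ.+-cancelˡ-≡ nD _ _ (begin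
        nD + 2 * K                             ≡⟨ cong₂ _+_ (sym (sum-const nD)) (sym sum-IJ) ⟩
        sum {nD} (λ _ → 1) + sum (λ x → I x * J x)  ≡⟨ sym (∑-distrib-+ {nD} (λ _ → 1) (λ x → I x * J x)) ⟩
        sum (λ x → 1 + I x * J x)              ≡⟨ sum-cong-≗ (λ x → sym (incl-excl x)) ⟩
        sum (λ x → I x + J x)                  ≡⟨ ∑-distrib-+ I J ⟩
        sum I + sum J                          ≡⟨ cong₂ _+_ (trans (sum-double a) (cong (2 *_) count-a))
            (trans (sum-double b) (cong (2 *_) count-b)) ⟩
        2 * nV + 2 * nF                        ≡⟨ sym (ℕ.*-distribˡ-+ 2 nV nF) ⟩
        2 * (nV + nF)                          ≡⟨ euler ⟩
        nD + 4                                 ∎))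
        where open ≡-Reasoning

      ⟦⟧≤1 : {P : Set} (d : Dec P) → ⟦ d ⟧ ≤ 1
      ⟦⟧≤1 (yes _) = s≤s z≤n
      ⟦⟧≤1 (no _)  = z≤n

      crossing-from : ∀ x → J x ≡ 1 → Crossing x
      crossing-from x p = go (crossing? x) (trans (sym (J-crossing x)) p)
        where
        go : (d : Dec (Crossing x)) → ⟦ d ⟧ ≡ 1 → Crossing x
        go (yes q) _ = q
        go (no _)  ()

    abstract
      two-crossings : ∃[ u ] ∃[ v ] (u ≢ v × Crossing (C.o u) × Crossing (C.o v))
      two-crossings =
        let u , v , u≢v , hu , hv = sum≡2 (J ∘ C.o) (λ i → subst (_≤ 1) (sym (J-crossing _)) (⟦⟧≤1 (crossing? _))) K≡2
        in u , v , u≢v , crossing-from _ hu , crossing-from _ hv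

-- Betweenness and monotone sums.

walk-vertices : ∀ {n V} {α : Fin n → Fin n} {lab : Fin n → Fin V} {ok : Fin V → Set} {A : Set} (t : Fin V → A) →
                (∀ x → t (lab x) ≡ t (lab (α x))) → ∀ {u v} → Walk α lab ok u v → t u ≡ t v
walk-vertices t const (Walk.here _)          = refl
walk-vertices t const (Walk.step d refl _ w) = trans (const d) (walk-vertices t const w)

Between : ℕ → ℕ → ℕ → Set
Between a b c = (a ≤ b × b ≤ c) ⊎ (c ≤ b × b ≤ a)

between-sym : ∀ {a b c} → Between a b c → Between c b a
between-sym (inj₁ p) = inj₂ p
between-sym (inj₂ p) = inj₁ p

⟦⟧-mono : {P Q : Set} (p : Dec P) (q : Dec Q) → (P → Q) → ⟦ p ⟧ ≤ ⟦ q ⟧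
⟦⟧-mono (yes p) q f = ℕ.≤-reflexive (sym (⟦⟧-yes q (f p)))
⟦⟧-mono (no _)  q f = z≤n

sum-≤ : ∀ {n} {g h : Fin n → ℕ} → (∀ i → g i ≤ h i) → sum g ≤ sum h
sum-≤ {zero}  le = z≤n
sum-≤ {suc n} le = ℕ.+-mono-≤ (le zero) (sum-≤ (le ∘ suc))

sum-< : ∀ {n} {g h : Fin n → ℕ} → (∀ i → g i ≤ h i) → ∀ j → g j < h j → sum g < sum h
sum-< le zero    lt = ℕ.+-mono-<-≤ lt (sum-≤ (le ∘ suc))
sum-< le (suc j) lt = ℕ.+-mono-≤-< (le zero) (sum-< (le ∘ suc) j lt)

-- The edges of the dual cycle as nested chords of the primal one.

module Strip (M : PlanarMap) (simple : Simple M) (2conn : TwoConnected M)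
             (outerplanar : WeaklyOuterplanar M) (dualOuterplanar : DualWeaklyOuterplanar M) where

  open PlanarMap M
  open Main M simple 2conn outerplanar dualOuterplanar

  in-face : ∀ {x f} → fc x ≡ f → fc (φ x) ≡ f
  in-face {x} p = trans (lab-step fc-orbits x) p

  vtx-φ : ∀ x → vtx (φ x) ≡ vtx (α x)
  vtx-φ x = lab-step vtx-orbits (α x)

  -- The dual cycle passes through each face once, so it uses one edge of `f` to leave and one to
  -- enter.
  face-crossings : ∀ {f f′ x} → C*.next f′ ≡ f → fc x ≡ f → Crossing x → x ≡ C*.o f ⊎ x ≡ α (C*.o f′)
  face-crossings nf fx (inj₁ p) = inj₁ (trans (C*.outer≡o p) (cong C*.o fx))
  face-crossings {f} {f′} {x} nf fx (inj₂ p) = inj₂ (trans (sym (α-invol x)) (cong α (trans (C*.outer≡o p) (cong C*.o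
    (C*.next-injective (trans (trans (cong (fc ∘ α) (sym (C*.outer≡o p))) (trans (cong fc (α-invol x)) fx))
        (sym nf)))))))

  -- Going round a face, a vertex function that is unchanged along all but one dart is unchanged along that one too.
  cut-connected : {A : Set} (t : Fin nV → A) → (∀ x → ¬ Crossing x → t (vtx x) ≡ t (vtx (α x))) →
                  ∀ g → Crossing g → t (vtx g) ≡ t (vtx (α g)) → ∀ u v → t u ≡ t v
  cut-connected t off g cross good-g u v = walk-vertices t all (connected u v)
    where
    Good : Fin nD → Set
    Good x = t (vtx x) ≡ t (vtx (α x))
    good-α : ∀ {x} → Good (α x) → Good x
    good-α {x} p = trans (cong (t ∘ vtx) (sym (α-invol x))) (sym p)
    propagate : ∀ f → Good (C*.o f) → Good (C*.o (C*.next f))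
    propagate f good = proj₂ (walk (λ z → fc z ≡ F × t (vtx z) ≡ t (vtx (α p)))
        (λ z z≢p (fz , tz) → in-face fz , trans (cong t (vtx-φ z)) (trans (sym (good-z z z≢p fz (crossing? z))) tz))
        (orbit-return φ-inj p) (in-face (C*.lab-o F) , cong t (vtx-φ p)))
      where
      F = C*.next f
      p = C*.o F
      good-z : ∀ z → z ≢ p → fc z ≡ F → Dec (Crossing z) → Good z
      good-z z z≢p fz (no ¬c) = off z ¬c
      good-z z z≢p fz (yes c) = [ (λ q → ⊥-elim (z≢p q)) ,
        (λ q → good-α (subst Good (sym (trans (cong α q) (α-invol _))) good)) ]′ (face-crossings refl fz c)
    start : ∃[ f ] Good (C*.o f)
    start = [ (λ p → fc g , subst Good (C*.outer≡o p) good-g) ,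
              (λ p → fc (α g) , subst Good (C*.outer≡o p) (good-α (subst Good (sym (α-invol g)) good-g))) ]′ cross
    -- Each face hands the property on to the next one, all around the dual cycle.
    good-o : ∀ f → Good (C*.o f)
    good-o f = walk (Good ∘ C*.o) (λ z _ → propagate z) (C*.next-orbit (proj₁ start) f) (proj₂ start)
    all : ∀ x → Good x
    all x = cases (crossing? x)
      where
      cases : Dec (Crossing x) → Good x
      cases (no ¬c) = off x ¬c
      cases (yes (inj₁ p)) = subst Good (sym (C*.outer≡o p)) (good-o _)
      cases (yes (inj₂ p)) = good-α (subst Good (sym (C*.outer≡o p)) (good-o _))

  module Cut (vl vm : Fin nV) (vl≢vm : vl ≢ vm) (cross-l : Crossing (C.o vl)) (cross-m : Crossing (C.o vm)) where

    next = C.next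
    -- Positions start just behind the cut edge leaving `vl`. Thus `vl` comes last, and `next`
    -- raises the position by one everywhere else.
    v₀ = next vl

    abstract
      first-visit : ∀ v → ∃[ j ] (iter next j v₀ ≡ v × (∀ i → i < j → iter next i v₀ ≢ v))
      first-visit v = let k , eq = C.next-orbit v₀ v in least (λ k → iter next k v₀ ≟ v) k eq

      pos : Fin nV → ℕ
      pos v = proj₁ (first-visit v)

      iter-pos : ∀ v → iter next (pos v) v₀ ≡ v
      iter-pos v = proj₁ (proj₂ (first-visit v))

      pos-least : ∀ {i v} → iter next i v₀ ≡ v → pos v ≤ i
      pos-least {i} {v} p = ℕ.≮⇒≥ λ lt → proj₂ (proj₂ (first-visit v)) i lt p

    pos-injective : ∀ {u v} → pos u ≡ pos v → u ≡ v
    pos-injective {u} {v} p = trans (sym (iter-pos u)) (trans (cong (λ k → iter next k v₀) p) (iter-pos v))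

    pos-v₀ : pos v₀ ≡ 0
    pos-v₀ = ℕ.n≤0⇒n≡0 (pos-least refl)

    pos-next : ∀ {v} → v ≢ vl → pos (next v) ≡ suc (pos v)
    pos-next {v} v≢vl = ℕ.≤-antisym (pos-least (cong next (iter-pos v))) (lower (pos (next v)) (iter-pos (next v)))
      where
      lower : ∀ j → iter next j v₀ ≡ next v → suc (pos v) ≤ j
      lower zero    p = ⊥-elim (v≢vl (sym (C.next-injective p)))
      lower (suc j) p = s≤s (pos-least (C.next-injective p))

    -- An earlier visit to the `j`-th vertex would shorten the way to `w`.
    pos-prefix : ∀ {w j} → j ≤ pos w → pos (iter next j v₀) ≡ j
    pos-prefix {w} {j} j≤ = ℕ.≤-antisym (pos-least refl) (ℕ.+-cancelˡ-≤ (pos w ∸ j) _ _ (begin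
        pos w ∸ j + j                        ≡⟨ ℕ.m∸n+n≡m j≤ ⟩
        pos w                                ≤⟨ pos-least reaches ⟩
        pos w ∸ j + pos (iter next j v₀)     ∎))
      where
      open ℕ.≤-Reasoning
      reaches : iter next (pos w ∸ j + pos (iter next j v₀)) v₀ ≡ w
      reaches = trans (iter-+ next (pos w ∸ j) _ v₀) (trans (cong (iter next (pos w ∸ j)) (iter-pos _))
        (trans (sym (iter-+ next (pos w ∸ j) j v₀)) (trans (cong (λ k → iter next k v₀) (ℕ.m∸n+n≡m j≤)) (iter-pos w))))

    m : ℕ
    m = pos vm

    -- The second cut edge leaves `vm`, so the top path occupies the positions 0 to `m`.
    top : Fin nV → ℕ
    top v = ⟦ pos v ≤? m ⟧

    top-next : ∀ {v} → v ≢ vl → v ≢ vm → top v ≡ top (next v)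
    top-next {v} v≢vl v≢vm = cases (pos v ≤? m) (pos (next v) ≤? m)
      where
      cases : (p : Dec (pos v ≤ m)) (q : Dec (pos (next v) ≤ m)) → ⟦ p ⟧ ≡ ⟦ q ⟧
      cases (yes p) (yes q) = refl
      cases (yes p) (no q)  = ⊥-elim (q (subst (_≤ m) (sym (pos-next v≢vl)) (ℕ.≤∧≢⇒< p (v≢vm ∘ pos-injective))))
      cases (no p)  (yes q) = ⊥-elim (p (ℕ.≤-trans (ℕ.n≤1+n _) (subst (_≤ m) (pos-next v≢vl) q)))
      cases (no p)  (no q)  = refl

    noncrossing-o : ∀ {v} → ¬ Crossing (C.o v) → v ≢ vl × v ≢ vm
    noncrossing-o ¬c = (λ { refl → ¬c cross-l }) , (λ { refl → ¬c cross-m })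

    up : ∀ {x} → C.Outer x → ¬ Crossing x → vtx x ≢ vl × vtx x ≢ vm
    up Ox ¬c = noncrossing-o (subst (λ z → ¬ Crossing z) (C.outer≡o Ox) ¬c)

    next-vtx : ∀ {x} → C.Outer x → next (vtx x) ≡ vtx (α x)
    next-vtx Ox = cong (vtx ∘ α) (sym (C.outer≡o Ox))

    -- An edge off the dual cycle lies on the primal one, and it is neither of the two cut edges,
    -- since these lie on both.
    top-uncrossed : ∀ x → ¬ Crossing x → top (vtx x) ≡ top (vtx (α x))
    top-uncrossed x ¬c = [ (λ Ox → along Ox ¬c) ,
        (λ Oαx → sym (trans (along Oαx (λ c → ¬c (subst Crossing (α-invol x) (crossing-α c))))
            (cong (top ∘ vtx) (α-invol x)))) ]′ (covered x ¬c)
      where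
      along : ∀ {x} → C.Outer x → ¬ Crossing x → top (vtx x) ≡ top (vtx (α x))
      along Ox ¬c = let l , r = up Ox ¬c in trans (top-next l r) (cong top (next-vtx Ox))

    -- Otherwise `cut-connected` makes `top` constant, although it tells `v₀` from `next vm`, which
    -- has position `m + 1`.
    crossing-sides : ∀ {x} → Crossing x → top (vtx x) ≢ top (vtx (α x))
    crossing-sides {x} cx eq = ℕ.1+n≢0 (trans (sym (⟦⟧-yes (pos v₀ ≤? m) (subst (_≤ m) (sym pos-v₀) z≤n)))
      (trans (cut-connected top top-uncrossed x cx eq v₀ (next vm))
        (⟦⟧-no (pos (next vm) ≤? m) (λ p → ℕ.1+n≰n (subst (_≤ m) (pos-next (vl≢vm ∘ sym)) p)))))

    Top : Fin nD → Set
    Top x = pos (vtx x) ≤ m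

    crossing-below : ∀ {x} → Crossing x → Top x → m < pos (vtx (α x))
    crossing-below {x} cx tx = ℕ.≰⇒> λ q → crossing-sides cx
        (trans (⟦⟧-yes (pos (vtx x) ≤? m) tx) (sym (⟦⟧-yes (pos (vtx (α x)) ≤? m) q)))

    crossing-above : ∀ {x} → Crossing x → ¬ Top x → Top (α x)
    crossing-above {x} cx ¬tx = decidable-stable (_ ≤? m) λ q → crossing-sides cx
        (trans (⟦⟧-no (pos (vtx x) ≤? m) ¬tx) (sym (⟦⟧-no (pos (vtx (α x)) ≤? m) q)))

    module _ (e : Fin nD) {k} (c : Fin nD → Fin k)
             (α-inv : ∀ x → ¬ Touches x e → c (α x) ≡ c x)
             (const : ∀ x y → vtx x ≡ vtx y → vtx x ≢ vtx e × vtx x ≢ vtx (α e) → c x ≡ c y) where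

      Clear : Fin nV → Set
      Clear z = z ≢ vtx e × z ≢ vtx (α e)

      -- Walks back along the cycle from `x` to `s`, with `i` vertices strictly between. Every edge
      -- passed has an end clear of `e`, hence differs from `e` and keeps the colour.
      arc-colour : ∀ s i x → pos (vtx x) ≡ suc (i + pos s) →
                   (∀ z → pos s < pos z → pos z ≤ pos (vtx x) → Clear z) → c x ≡ c (C.o s)
      arc-colour s i x px clear =
        trans (const x (α (C.o w′)) (sym nw′) clear-x) (trans (α-inv (C.o w′) real) (previous i refl))
        where
        w′ = iter next (i + pos s) v₀
        nw′ : next w′ ≡ vtx x
        nw′ = trans (cong (λ j → iter next j v₀) (sym px)) (iter-pos (vtx x))
        pos-w′ : pos w′ ≡ i + pos s
        pos-w′ = pos-prefix (subst (i + pos s ≤_) (sym px) (ℕ.n≤1+n _))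
        clear-x : Clear (vtx x)
        clear-x = clear (vtx x) (subst (pos s <_) (sym px) (s≤s (ℕ.m≤n+m _ i))) ℕ.≤-refl
        real : ¬ Touches (C.o w′) e
        real (inj₁ p) = proj₂ clear-x (trans (sym nw′) (cong (vtx ∘ α) p))
        real (inj₂ p) = proj₁ clear-x (trans (sym nw′) (trans (cong (vtx ∘ α) p) (cong vtx (α-invol e))))
        previous : ∀ j → i ≡ j → c (C.o w′) ≡ c (C.o s)
        previous zero    refl = cong (c ∘ C.o) (pos-injective pos-w′)
        previous (suc j) refl = arc-colour s j (C.o w′) (trans (cong pos (C.lab-o w′)) pos-w′)
          (λ z lo hi → clear z lo (ℕ.≤-trans hi (subst (_≤ pos (vtx x)) (sym (trans (cong pos (C.lab-o w′)) pos-w′))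
              (subst (i + pos s ≤_) (sym px) (ℕ.n≤1+n _)))))

    -- If the ends interleave, `e′` has the colour of one arc cut off by `e` and `α e′` that of the
    -- other, but an edge other than `e` has a single colour.
    noncrossing : ∀ e e′ → pos (vtx e) < pos (vtx e′) → pos (vtx e′) < pos (vtx (α e)) →
                  pos (vtx (α e)) < pos (vtx (α e′)) → ⊥
    noncrossing e e′ p q r =
      let _ , c , differ , α-inv , const = C.arcs e
          inner : c e′ ≡ c (C.o (vtx e))
          inner = arc-colour e c α-inv const (vtx e) _ e′ (above p)
                    (λ z lo hi → (λ { refl → ℕ.<-irrefl refl lo }) , (λ { refl → ℕ.<-irrefl refl (ℕ.≤-<-trans hi q) }))
          outer : c (α e′) ≡ c (C.o (vtx (α e)))
          outer = arc-colour e c α-inv const (vtx (α e)) _ (α e′) (above r)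
                    (λ z lo hi → (λ { refl → ℕ.<-asym lo (ℕ.<-trans p q) }) , (λ { refl → ℕ.<-irrefl refl lo }))
      in differ (trans (sym inner) (trans (sym (α-inv e′ real)) outer))
      where
      above : ∀ {a b} → a < b → b ≡ suc ((b ∸ suc a) + a)
      above {a} {b} lt = trans (sym (ℕ.m∸n+n≡m lt)) (ℕ.+-suc (b ∸ suc a) a)
      real : ¬ Touches e′ e
      real (inj₁ refl) = ℕ.<-irrefl refl p
      real (inj₂ refl) = ℕ.<-irrefl refl q

    -- For darts starting on the top path: the interval of positions spanned by `x` contains that of
    -- `y`.
    _⊒_ : Fin nD → Fin nD → Set
    x ⊒ y = pos (vtx x) ≤ pos (vtx y) × pos (vtx (α y)) ≤ pos (vtx (α x))

    -- Top ends precede all bottom ends, so two intervals that are not nested would interleave.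
    nested : ∀ {x y} → Crossing x → Crossing y → Top x → Top y → x ⊒ y ⊎ y ⊒ x
    nested {x} {y} cx cy tx ty with ℕ.<-cmp (pos (vtx x)) (pos (vtx y)) | ℕ.≤-total (pos (vtx (α y))) (pos (vtx (α x)))
    nested cx cy tx ty | tri< a _ _ | inj₁ b = inj₁ (ℕ.<⇒≤ a , b)
    nested cx cy tx ty | tri≈ _ a _ | inj₁ b = inj₁ (ℕ.≤-reflexive a , b)
    nested cx cy tx ty | tri≈ _ a _ | inj₂ b = inj₂ (ℕ.≤-reflexive (sym a) , b)
    nested cx cy tx ty | tri> _ _ a | inj₂ b = inj₂ (ℕ.<⇒≤ a , b)
    nested {x} {y} cx cy tx ty | tri< a _ _ | inj₂ b with ℕ.m≤n⇒m<n∨m≡n b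
    ... | inj₁ b′ = ⊥-elim (noncrossing x y a (ℕ.≤-<-trans ty (crossing-below cx tx)) b′)
    ... | inj₂ b′ = inj₁ (ℕ.<⇒≤ a , ℕ.≤-reflexive (sym b′))
    nested {x} {y} cx cy tx ty | tri> _ _ a | inj₁ b with ℕ.m≤n⇒m<n∨m≡n b
    ... | inj₁ b′ = ⊥-elim (noncrossing y x a (ℕ.≤-<-trans tx (crossing-below cy ty)) b′)
    ... | inj₂ b′ = inj₂ (ℕ.<⇒≤ a , ℕ.≤-reflexive (sym b′))

    -- A face boundary keeps its direction along the cycle: turning back would retrace the edge just
    -- used and make `α x` a fixed point of `σ`. The same holds for `down-φ`.
    up-φ : ∀ {x} → C.Outer x → ¬ Crossing (φ x) → C.Outer (φ x)
    up-φ {x} Ox ¬c = [ (λ p → p) , (λ p → ⊥-elim (σ-moves (α x) (trans (sym (α-invol _)) (cong α (turn p))))) ]′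
        (covered (φ x) ¬c)
      where
      turn : C.Outer (α (φ x)) → α (φ x) ≡ x
      turn p = trans (C.outer≡o p) (trans (cong C.o (C.next-injective
        (trans (next-vtx p) (trans (cong vtx (α-invol (φ x))) (trans (vtx-φ x) (sym (next-vtx Ox)))))))
            (sym (C.outer≡o Ox)))

    down-φ : ∀ {x} → C.Outer (α x) → ¬ Crossing (φ x) → C.Outer (α (φ x))
    down-φ {x} Oαx ¬c = [ (λ p → ⊥-elim (σ-moves (α x) (C.outer-unique _ _ p Oαx (vtx-φ x)))) , (λ p → p) ]′
        (covered (φ x) ¬c)

    up-pos : ∀ {x} → C.Outer x → ¬ Crossing x → pos (vtx (φ x)) ≡ suc (pos (vtx x))
    up-pos {x} Ox ¬c = trans (cong pos (trans (vtx-φ x) (sym (next-vtx Ox)))) (pos-next (proj₁ (up Ox ¬c)))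

    down-pos : ∀ {x} → C.Outer (α x) → ¬ Crossing x → suc (pos (vtx (φ x))) ≡ pos (vtx x)
    down-pos {x} Oαx ¬c = trans (cong (suc ∘ pos) (vtx-φ x)) (trans (sym (pos-next (proj₁ (up Oαx
        (λ c → ¬c (subst Crossing (α-invol x) (crossing-α c)))))))
      (cong pos (trans (next-vtx Oαx) (cong vtx (α-invol x)))))

    -- Faces as strips between two chords.

    module Stretch (S : Fin nD) (k : ℕ) (free : ∀ i → i < k → ¬ Crossing (iter φ i S)) where

      P : ℕ → ℕ
      P i = pos (vtx (iter φ i S))

      ups : C.Outer S → ∀ i → i < k → C.Outer (iter φ i S)
      ups O zero    lt = O
      ups O (suc i) lt = up-φ (ups O i (ℕ.<-trans (ℕ.n<1+n i) lt)) (free (suc i) lt)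

      downs : C.Outer (α S) → ∀ i → i < k → C.Outer (α (iter φ i S))
      downs O zero    lt = O
      downs O (suc i) lt = down-φ (downs O i (ℕ.<-trans (ℕ.n<1+n i) lt)) (free (suc i) lt)

      rising : C.Outer S → ∀ i → i ≤ k → P i ≡ i + P 0
      rising O zero    le = refl
      rising O (suc i) le = trans (up-pos (ups O i le) (free i le)) (cong suc (rising O i (ℕ.<⇒≤ le)))

      falling : C.Outer (α S) → ∀ i → i ≤ k → i + P i ≡ P 0
      falling O zero    le = refl
      falling O (suc i) le = trans (sym (ℕ.+-suc i _)) (trans (cong (i +_) (down-pos (downs O i le) (free i le)))
          (falling O i (ℕ.<⇒≤ le)))

      -- The first dart decides the direction; an empty stretch counts as rising.
      monotone : (∀ i → i ≤ k → P i ≡ i + P 0) ⊎ (∀ i → i ≤ k → i + P i ≡ P 0)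
      monotone = cases (0 <? k)
        where
        cases : Dec (0 < k) → (∀ i → i ≤ k → P i ≡ i + P 0) ⊎ (∀ i → i ≤ k → i + P i ≡ P 0)
        cases (yes 0<k) = [ (λ O → inj₁ (rising O)) , (λ O → inj₂ (falling O)) ]′ (covered S (free 0 0<k))
        cases (no 0≮k)  = inj₁ λ { zero _ → refl ; (suc i) le → ⊥-elim (0≮k (ℕ.≤-trans (s≤s z≤n) le)) }

      within : ∀ i → i ≤ k → Between (P 0) (P i) (P k)
      within i le = [ (λ r → inj₁ (subst (P 0 ≤_) (sym (r i le)) (ℕ.m≤n+m _ i) ,
                                   subst (P i ≤_) (sym (r k ℕ.≤-refl))
                                       (subst (_≤ k + P 0) (sym (r i le)) (ℕ.+-monoˡ-≤ (P 0) le)))) ,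
                      (λ r → inj₂ (ℕ.+-cancelˡ-≤ k _ _ (subst (_≤ k + P i) (sym (r k ℕ.≤-refl))
                          (subst (_≤ k + P i) (r i le) (ℕ.+-monoˡ-≤ (P i) le))) ,
                                   subst (P i ≤_) (r i le) (ℕ.m≤n+m _ i))) ]′ monotone

      -- Positions change by one per step, so none is skipped; the index sought is the distance from
      -- `P 0`.
      onto : ∀ w → Between (P 0) (pos w) (P k) → ∃[ i ] vtx (iter φ i S) ≡ w
      onto w b = [ (λ r → rise r b) , (λ r → fall r b) ]′ monotone
        where
        rise : (∀ i → i ≤ k → P i ≡ i + P 0) → Between (P 0) (pos w) (P k) → ∃[ i ] vtx (iter φ i S) ≡ w
        rise r b = i , pos-injective (trans (r i (ℕ.+-cancelʳ-≤ (P 0) i k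
            (subst (_≤ k + P 0) (sym i+) (subst (pos w ≤_) (r k ℕ.≤-refl) hi)))) i+)
          where
          order : P 0 ≤ pos w × pos w ≤ P k
          order = [ (λ p → p) , (λ (p , q) → ℕ.≤-trans (subst (P 0 ≤_) (sym (r k ℕ.≤-refl)) (ℕ.m≤n+m _ k)) p ,
                                             ℕ.≤-trans q (subst (P 0 ≤_) (sym (r k ℕ.≤-refl)) (ℕ.m≤n+m _ k))) ]′ b
          hi = proj₂ order
          i = pos w ∸ P 0
          i+ : i + P 0 ≡ pos w
          i+ = ℕ.m∸n+n≡m (proj₁ order)
        fall : (∀ i → i ≤ k → i + P i ≡ P 0) → Between (P 0) (pos w) (P k) → ∃[ i ] vtx (iter φ i S) ≡ w
        fall r b = i , pos-injective (ℕ.+-cancelˡ-≡ i _ _ (trans (r i (ℕ.+-cancelʳ-≤ (pos w) i k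
                     (subst (_≤ k + pos w) (sym i+) (subst (_≤ k + pos w) (r k ℕ.≤-refl)
                         (ℕ.+-monoʳ-≤ k (proj₁ order)))))) (sym i+)))
          where
          Pk≤P0 : P k ≤ P 0
          Pk≤P0 = subst (P k ≤_) (r k ℕ.≤-refl) (ℕ.m≤n+m _ k)
          order : P k ≤ pos w × pos w ≤ P 0
          order = [ (λ (p , q) → ℕ.≤-trans Pk≤P0 p , ℕ.≤-trans q Pk≤P0) , (λ p → p) ]′ b
          i = P 0 ∸ pos w
          i+ : i + pos w ≡ P 0
          i+ = ℕ.m∸n+n≡m (proj₂ order)

    -- The face is a strip between an outer chord `a` and an inner chord `b`. Its top side runs from
    -- `a` to `b`, its bottom side from `α b` to `α a`; `inside` and `filled` say that its vertices
    -- are exactly those on the two sides.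
    record Bounds (f : Fin nF) : Set where
      field
        a b        : Fin nD
        a-crossing : Crossing a
        b-crossing : Crossing b
        a-top      : Top a
        b-top      : Top b
        a⊒b        : a ⊒ b
        inside     : ∀ x → fc x ≡ f →
                     (pos (vtx a) ≤ pos (vtx x) × pos (vtx x) ≤ pos (vtx b)) ⊎
                     (pos (vtx (α b)) ≤ pos (vtx x) × pos (vtx x) ≤ pos (vtx (α a)))
        filled     : ∀ w → (pos (vtx a) ≤ pos w × pos w ≤ pos (vtx b)) ⊎
                           (pos (vtx (α b)) ≤ pos w × pos w ≤ pos (vtx (α a))) →
                     ∃[ d ] (vtx d ≡ w × fc d ≡ f)

    module _ (f : Fin nF) where

      private
        before = predecessor C*.next-injective f
        f′ = proj₁ before
        -- The darts by which the dual cycle leaves `f` for the next face and came in from the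
        -- previous face `f′`, both taken on the side of `f`.
        p q : Fin nD
        p = C*.o f
        q = α (C*.o f′)
        p-crossing : Crossing p
        p-crossing = inj₁ (C*.o-outer f)
        q-crossing : Crossing q
        q-crossing = crossing-α (inj₁ (C*.o-outer f′))
        fc-p : fc p ≡ f
        fc-p = C*.lab-o f
        fc-q : fc q ≡ f
        fc-q = proj₁ (proj₂ before)
        End : Fin nD → Set
        End x = x ≡ p ⊎ x ≡ q
        end? : Decidable End
        end? x = (x ≟ p) ⊎-dec (x ≟ q)

        fc-iter : ∀ {S} → fc S ≡ f → ∀ i → fc (iter φ i S) ≡ f
        fc-iter fS zero    = fS
        fc-iter fS (suc i) = in-face (fc-iter fS i)

        top-iter : ∀ S k → (∀ i → i < k → ¬ Crossing (iter φ i S)) → top (vtx (iter φ k S)) ≡ top (vtx S)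
        top-iter S zero    free = refl
        top-iter S (suc k) free = trans (trans (cong top (vtx-φ _)) (sym (top-uncrossed _ (free k (ℕ.n<1+n k)))))
          (top-iter S k (λ i lt → free i (ℕ.m<n⇒m<1+n lt)))

        -- From φ x the face walk cannot return to x before crossing back through the other end y.
        abstract
          stretch : ∀ x y → fc x ≡ f → Crossing x → (∀ {z} → End z → z ≡ x ⊎ z ≡ y) → (∀ {z} → z ≡ x → End z) →
                    ∃[ k ] (iter φ k (φ x) ≡ y × (∀ i → i < k → ¬ Crossing (iter φ i (φ x))))
          stretch x y fx cx ends x-end with orbit-return φ-inj x
          ... | j , eq with least (λ k → end? (iter φ k (φ x))) j (x-end eq)
          ... | k , e , first = k , [ (λ e≡x → ⊥-elim (crossing-sides cx
                  (trans (sym (trans (sym (top-iter (φ x) k free)) (cong (top ∘ vtx) e≡x))) (cong top (vtx-φ x)))))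
                , (λ e≡y → e≡y) ]′ (ends e) , free
            where
            free : ∀ i → i < k → ¬ Crossing (iter φ i (φ x))
            free i lt c = first i lt (face-crossings fc-q (fc-iter (in-face fx) i) c)

        swap-end : ∀ {z} → z ≡ p ⊎ z ≡ q → z ≡ q ⊎ z ≡ p
        swap-end = [ inj₂ , inj₁ ]′

        s₁ = stretch p q fc-p p-crossing (λ e → e) inj₁
        s₂ = stretch q p fc-q q-crossing swap-end inj₂
        k₁ = proj₁ s₁
        k₂ = proj₁ s₂
        module S₁ = Stretch (φ p) k₁ (proj₂ (proj₂ s₁))
        module S₂ = Stretch (φ q) k₂ (proj₂ (proj₂ s₂))

        P : Fin nD → ℕ
        P x = pos (vtx x)

        S₁0 : S₁.P 0 ≡ P (α p)
        S₁0 = cong pos (vtx-φ p)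
        S₁k : S₁.P k₁ ≡ P q
        S₁k = cong P (proj₁ (proj₂ s₁))
        S₂0 : S₂.P 0 ≡ P (α q)
        S₂0 = cong pos (vtx-φ q)
        S₂k : S₂.P k₂ ≡ P p
        S₂k = cong P (proj₁ (proj₂ s₂))

        Located : Fin nD → Set
        Located z = (∃[ i ] (i ≤ k₁ × iter φ i (φ p) ≡ z)) ⊎ (∃[ i ] (i ≤ k₂ × iter φ i (φ q) ≡ z))

        locate : ∀ x → fc x ≡ f → Located x
        locate x fx = walk Located (λ z _ → advance z)
            (OrbitLabelling.sameLab⇒ fc-orbits (φ p) x (trans (in-face fc-p) (sym fx))) (inj₁ (0 , z≤n , refl))
          where
          advance : ∀ z → Located z → Located (φ z)
          -- The first stretch ends in `q`, where the second one takes over; that one ends in `p`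
          -- and leads back to the first.
          advance z (inj₁ (i , le , eq)) =
            [ (λ lt → inj₁ (suc i , lt , cong φ eq))
            , (λ i≡ → inj₂ (0 , z≤n , cong φ (trans (sym (proj₁ (proj₂ s₁)))
                (trans (cong (λ j → iter φ j (φ p)) (sym i≡)) eq))))
            ]′ (ℕ.m≤n⇒m<n∨m≡n le)
          advance z (inj₂ (i , le , eq)) =
            [ (λ lt → inj₂ (suc i , lt , cong φ eq))
            , (λ i≡ → inj₁ (0 , z≤n , cong φ (trans (sym (proj₁ (proj₂ s₂)))
                (trans (cong (λ j → iter φ j (φ q)) (sym i≡)) eq))))
            ]′ (ℕ.m≤n⇒m<n∨m≡n le)

        inside′ : ∀ x → fc x ≡ f → Between (P (α p)) (P x) (P q) ⊎ Between (P (α q)) (P x) (P p)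
        inside′ x fx = cases (locate x fx)
          where
          cases : Located x → Between (P (α p)) (P x) (P q) ⊎ Between (P (α q)) (P x) (P p)
          cases (inj₁ (i , le , eq)) = inj₁ (subst (λ a → Between a _ (P q)) S₁0 (subst (Between (S₁.P 0) (P x)) S₁k
            (subst (λ z → Between (S₁.P 0) (P z) (S₁.P k₁)) eq (S₁.within i le))))
          cases (inj₂ (i , le , eq)) = inj₂ (subst (λ a → Between a _ (P p)) S₂0 (subst (Between (S₂.P 0) (P x)) S₂k
            (subst (λ z → Between (S₂.P 0) (P z) (S₂.P k₂)) eq (S₂.within i le))))

        filled′ : ∀ w → Between (P (α p)) (pos w) (P q) ⊎ Between (P (α q)) (pos w) (P p) → ∃[ d ]
            (vtx d ≡ w × fc d ≡ f)
        filled′ w (inj₁ b) = let i , e = S₁.onto w (subst (λ a → Between a (pos w) (S₁.P k₁)) (sym S₁0)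
                                   (subst (Between (P (α p)) (pos w)) (sym S₁k) b))
                             in _ , e , fc-iter (in-face fc-p) i
        filled′ w (inj₂ b) = let i , e = S₂.onto w (subst (λ a → Between a (pos w) (S₂.P k₂)) (sym S₂0)
                                   (subst (Between (P (α q)) (pos w)) (sym S₂k) b))
                             in _ , e , fc-iter (in-face fc-q) i

        top-q : top (vtx q) ≡ top (vtx (α p))
        top-q = trans (cong (top ∘ vtx) (sym (proj₁ (proj₂ s₁)))) (trans (top-iter (φ p) k₁ (proj₂ (proj₂ s₁)))
            (cong top (vtx-φ p)))

        ⟦≤⟧-top : ∀ {u v} → top u ≡ top v → pos u ≤ m → pos v ≤ m
        ⟦≤⟧-top {u} {v} eq le = decidable-stable (pos v ≤? m) λ ¬le →
          impossible (trans (sym (⟦⟧-yes (pos u ≤? m) le)) (trans eq (⟦⟧-no (pos v ≤? m) ¬le)))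
          where
          impossible : 1 ≡ 0 → ⊥
          impossible ()

        order≤ : ∀ {a b z} → a ≤ b → Between a z b → a ≤ z × z ≤ b
        order≤ le (inj₁ p) = p
        order≤ le (inj₂ (p , q)) = ℕ.≤-trans le p , ℕ.≤-trans q le

        -- x and y are the two ends of the face, both oriented from the top.
        package : ∀ x y → Crossing x → Crossing y → Top x → Top y →
          (∀ z → fc z ≡ f → Between (P x) (P z) (P y) ⊎ Between (P (α y)) (P z) (P (α x))) →
          (∀ w → Between (P x) (pos w) (P y) ⊎ Between (P (α y)) (pos w) (P (α x)) → ∃[ d ] (vtx d ≡ w × fc d ≡ f)) →
          Bounds f
        package x y cx cy tx ty ins fil = [ (λ (le , le′) → record
          { a = x ; b = y ; a-crossing = cx ; b-crossing = cy ; a-top = tx ; b-top = ty ; a⊒b = le , le′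
          ; inside = λ z fz → [ inj₁ ∘ order≤ le , inj₂ ∘ order≤ le′ ]′ (ins z fz)
          ; filled = λ w → fil w ∘ [ inj₁ ∘ inj₁ , inj₂ ∘ inj₁ ]′ })
          , (λ (le , le′) → record
          { a = y ; b = x ; a-crossing = cy ; b-crossing = cx ; a-top = ty ; b-top = tx ; a⊒b = le , le′
          ; inside = λ z fz → [ inj₁ ∘ order≤ le ∘ between-sym , inj₂ ∘ order≤ le′ ∘ between-sym ]′ (ins z fz)
          ; filled = λ w → fil w ∘ [ inj₁ ∘ inj₂ , inj₂ ∘ inj₂ ]′ })
          ]′ (nested cx cy tx ty)

      bounds : Bounds f
      bounds = cases (pos (vtx p) ≤? m)
        where
        αα : ∀ x → P (α (α x)) ≡ P x
        αα x = cong P (α-invol x)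
        cases : Dec (Top p) → Bounds f
        -- The stretch from `α p` to `q` stays on one side. So if `p` is on top, the chords oriented
        -- from the top are `p` and `α q`, and otherwise `α p` and `q`.
        cases (yes tp) = package p (α q) p-crossing (crossing-α q-crossing) tp
            (crossing-above q-crossing λ tq → ℕ.<⇒≱ (crossing-below p-crossing tp) (⟦≤⟧-top top-q tq))
            (λ z fz → [ (λ b → inj₂ (between-sym (subst (Between (P (α p)) (P z)) (sym (αα q)) b))) ,
                (λ b → inj₁ (between-sym b)) ]′ (inside′ z fz))
            (λ w → filled′ w ∘ [ (λ b → inj₂ (between-sym b)) ,
                (λ b → inj₁ (subst (Between (P (α p)) (pos w)) (αα q) (between-sym b))) ]′)
        cases (no ¬tp) = package (α p) q (crossing-α p-crossing) q-crossing tαp (⟦≤⟧-top (sym top-q) tαp)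
            (λ z fz → [ inj₁ , (λ b → inj₂ (subst (Between (P (α q)) (P z)) (sym (αα p)) b)) ]′ (inside′ z fz))
            (λ w → filled′ w ∘ [ inj₁ , (λ b → inj₂ (subst (Between (P (α q)) (pos w)) (αα p) b)) ]′)
          where
          tαp : Top (α p)
          tαp = crossing-above p-crossing ¬tp

    -- The two rank functions.

    P : Fin nD → ℕ
    P x = pos (vtx x)

    -- Requiring the dart to start on top picks one dart per edge, so that the sums below count
    -- edges.
    Chord : Fin nD → Set
    Chord x = Crossing x × Top x

    In Out : Fin nV → Fin nD → Set
    In v x  = Chord x × (P x < pos v × pos v < P (α x))
    Out v x = Chord x × (pos v < P x ⊎ P (α x) < pos v)

    chord? : Decidable Chord
    chord? x = crossing? x ×-dec (_ ≤? m)

    in? : ∀ v → Decidable (In v)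
    in? v x = chord? x ×-dec ((_ <? _) ×-dec (_ <? _))

    out? : ∀ v → Decidable (Out v)
    out? v x = chord? x ×-dec ((_ <? _) ⊎-dec (_ <? _))

    r₁ r₂ : Fin nV → ℕ
    r₁ v = sum (λ x → ⟦ in? v x ⟧)
    r₂ v = sum (λ x → ⟦ out? v x ⟧)

    nested′ : ∀ {x y} → Chord x → Chord y → x ⊒ y ⊎ y ⊒ x
    nested′ (cx , tx) (cy , ty) = nested cx cy tx ty

    -- A chord around `u` cannot be nested within `b`, as `b` would then surround `u` too. So it
    -- contains `b` and with it `v`, while `b` itself makes the inequality strict.
    r₁-< : ∀ {u v b} → In v b → ¬ In u b → r₁ u < r₁ v
    r₁-< {u} {v} {b} iv@(cb , lo , hi) ¬iu = sum-< (λ x → ⟦⟧-mono (in? u x) (in? v x) (grow x)) b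
        (ℕ.≤-reflexive (trans (cong suc (⟦⟧-no (in? u b) ¬iu)) (sym (⟦⟧-yes (in? v b) iv))))
      where
      grow : ∀ x → In u x → In v x
      grow x (cx , l , h) = [ (λ (p , q) → cx , ℕ.≤-<-trans p lo , ℕ.<-≤-trans hi q)
                            , (λ (p , q) → ⊥-elim (¬iu (cb , ℕ.≤-<-trans p l , ℕ.<-≤-trans h q))) ]′ (nested′ cx cb)

    -- The mirror image: a chord that leaves `u` outside lies within `a`, so it leaves `v` outside
    -- as well.
    r₂-< : ∀ {u v a} → Out v a → ¬ Out u a → r₂ u < r₂ v
    r₂-< {u} {v} {a} ov@(ca , side) ¬ou = sum-< (λ x → ⟦⟧-mono (out? u x) (out? v x) (grow x)) a
        (ℕ.≤-reflexive (trans (cong suc (⟦⟧-no (out? u a) ¬ou)) (sym (⟦⟧-yes (out? v a) ov))))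
      where
      grow : ∀ x → Out u x → Out v x
      grow x (cx , s) =
        [ (λ (p , q) → cx , [ (λ l → inj₁ (ℕ.<-≤-trans l p)) , (λ l → inj₂ (ℕ.≤-<-trans q l)) ]′ side)
        , (λ (p , q) → ⊥-elim (¬ou (ca , [ (λ l → inj₁ (ℕ.<-≤-trans l p)) , (λ l → inj₂ (ℕ.≤-<-trans q l)) ]′ s)))
        ]′ (nested′ ca cx)

    separates : ∀ v f → ¬ (∃[ d ] (vtx d ≡ v × fc d ≡ f)) →
                (∀ d → fc d ≡ f → r₁ (vtx d) < r₁ v) ⊎ (∀ d → fc d ≡ f → r₂ (vtx d) < r₂ v)
    separates v f ¬inc = cases (in? v b) (out? v a)
      where
      open Bounds (bounds f)
      below-a = crossing-below a-crossing a-top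
      below-b = crossing-below b-crossing b-top
      ¬in : ∀ d → fc d ≡ f → ¬ In (vtx d) b
      ¬in d fd (_ , lo , hi) = [ (λ (_ , q) → ℕ.<⇒≱ lo q) , (λ (p , _) → ℕ.<⇒≱ hi p) ]′ (inside d fd)
      ¬out : ∀ d → fc d ≡ f → ¬ Out (vtx d) a
      ¬out d fd (_ , side) =
        [ (λ (p , q) → [ (λ l → ℕ.<⇒≱ l p) , (λ l → ℕ.<⇒≱ l (ℕ.≤-trans q (ℕ.≤-trans b-top (ℕ.<⇒≤ below-a)))) ]′ side)
        , (λ (p , q) → [ (λ l → ℕ.<⇒≱ l (ℕ.≤-trans a-top (ℕ.≤-trans (ℕ.<⇒≤ below-b) p))) , (λ l → ℕ.<⇒≱ l q) ]′ side)
        ]′ (inside d fd)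
      cases : Dec (In v b) → Dec (Out v a) →
              (∀ d → fc d ≡ f → r₁ (vtx d) < r₁ v) ⊎ (∀ d → fc d ≡ f → r₂ (vtx d) < r₂ v)
      cases (yes i) _ = inj₁ λ d fd → r₁-< i (¬in d fd)
      cases (no _) (yes o) = inj₂ λ d fd → r₂-< o (¬out d fd)
      -- Neither strictly inside the inner chord nor strictly outside the outer one, `v` lies on a
      -- side of the strip and hence on `f`.
      cases (no ¬i) (no ¬o) = ⊥-elim (¬inc (filled v (located (pos v ≤? P b))))
        where
        a≤v : P a ≤ pos v
        a≤v = ℕ.≮⇒≥ λ l → ¬o ((a-crossing , a-top) , inj₁ l)
        v≤αa : pos v ≤ P (α a)
        v≤αa = ℕ.≮⇒≥ λ l → ¬o ((a-crossing , a-top) , inj₂ l)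
        located : Dec (pos v ≤ P b) → (P a ≤ pos v × pos v ≤ P b) ⊎ (P (α b) ≤ pos v × pos v ≤ P (α a))
        located (yes p) = inj₁ (a≤v , p)
        located (no p) = inj₂ (ℕ.≮⇒≥ (λ l → ¬i ((b-crossing , b-top) , ℕ.≰⇒> p , l)) , v≤αa)

  ranks : Σ (Fin nV → ℕ) λ r₁ → Σ (Fin nV → ℕ) λ r₂ → ∀ v f → ¬ (∃[ d ] (vtx d ≡ v × fc d ≡ f)) →
          (∀ d → fc d ≡ f → r₁ (vtx d) < r₁ v) ⊎ (∀ d → fc d ≡ f → r₂ (vtx d) < r₂ v)
  ranks = let vl , vm , vl≢vm , cross-l , cross-m = two-crossings
              open Cut vl vm vl≢vm cross-l cross-m
          in r₁ , r₂ , separates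

-- From two rank functions to three linear orders

-- Entries outside `P` count as 0, which is why `maxOver-least` asks for a positive bound.
maxOver : ∀ {n} {P : Fin n → Set} → Decidable P → (Fin n → ℕ) → ℕ
maxOver {zero}  P? h = 0
maxOver {suc n} P? h = ⟦ P? zero ⟧ * h zero ⊔ maxOver (P? ∘ suc) (h ∘ suc)

maxOver-upper : ∀ {n} {P : Fin n → Set} (P? : Decidable P) h i → P i → h i ≤ maxOver P? h
maxOver-upper P? h zero    p = ℕ.≤-trans (ℕ.≤-reflexive (sym (trans (cong (_* h zero) (⟦⟧-yes (P? zero) p))
    (ℕ.*-identityˡ _)))) (ℕ.m≤m⊔n _ _)
maxOver-upper P? h (suc i) p = ℕ.≤-trans (maxOver-upper (P? ∘ suc) (h ∘ suc) i p) (ℕ.m≤n⊔m _ _)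

maxOver-least : ∀ {n} {P : Fin n → Set} (P? : Decidable P) h {r} → (∀ i → P i → h i < r) → 0 < r → maxOver P? h < r
maxOver-least {zero}  P? h lt pos = pos
maxOver-least {suc n} P? h {r} lt pos = ℕ.⊔-pres-<m (head (P? zero))
    (maxOver-least (P? ∘ suc) (h ∘ suc) (λ i → lt (suc i)) pos)
  where
  head : (d : Dec _) → ⟦ d ⟧ * h zero < r
  head (yes p) = subst (_< r) (sym (ℕ.*-identityˡ _)) (lt zero p)
  head (no _)  = pos

module _ (M : PlanarMap) where

  open PlanarMap M

  Separates : (Fin nV → ℕ) → Fin nV → Fin nF → Set
  Separates r v f = ∀ d → fc d ≡ f → r (vtx d) < r v

  module Extension (r : Fin nV → ℕ) where

    peak : Fin nF → ℕ
    peak f = maxOver (λ d → fc d ≟ f) (r ∘ vtx)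

    -- Vertices get even keys and faces odd ones: a face lands just above its highest vertices and
    -- below every vertex of larger rank.
    key index : VF M → ℕ
    key (inj₁ v) = 2 * r v
    key (inj₂ f) = suc (2 * peak f)
    index (inj₁ v) = toℕ v
    index (inj₂ f) = nV + toℕ f

    index< : ∀ x → index x < nV + nF
    index< (inj₁ v) = ℕ.<-≤-trans (toℕ<n v) (ℕ.m≤m+n nV nF)
    index< (inj₂ f) = ℕ.+-monoʳ-< nV (toℕ<n f)

    index-injective : ∀ x y → index x ≡ index y → x ≡ y
    index-injective (inj₁ v) (inj₁ w) e = cong inj₁ (toℕ-injective e)
    index-injective (inj₁ v) (inj₂ g) e = ⊥-elim (ℕ.<⇒≱ (toℕ<n v) (subst (nV ≤_) (sym e) (ℕ.m≤m+n nV _)))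
    index-injective (inj₂ f) (inj₁ w) e = ⊥-elim (ℕ.<⇒≱ (toℕ<n w) (subst (nV ≤_) e (ℕ.m≤m+n nV _)))
    index-injective (inj₂ f) (inj₂ g) e = cong inj₂ (toℕ-injective (ℕ.+-cancelˡ-≡ nV _ _ e))

    -- Lexicographic order: `index` stays below `nV + nF` and only breaks ties between equal keys.
    rank : VF M → ℕ
    rank x = key x * (nV + nF) + index x

    rank-< : ∀ x y → key x < key y → rank x < rank y
    rank-< x y lt = begin-strict
      key x * (nV + nF) + index x      <⟨ ℕ.+-monoʳ-< (key x * (nV + nF)) (index< x) ⟩
      key x * (nV + nF) + (nV + nF)    ≡⟨ ℕ.+-comm (key x * (nV + nF)) (nV + nF) ⟩
      suc (key x) * (nV + nF)          ≤⟨ ℕ.*-monoˡ-≤ (nV + nF) lt ⟩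
      key y * (nV + nF)                ≤⟨ ℕ.m≤m+n _ _ ⟩
      rank y                           ∎
      where open ℕ.≤-Reasoning

    rank-injective : ∀ x y → rank x ≡ rank y → x ≡ y
    rank-injective x y e with ℕ.<-cmp (key x) (key y)
    ... | tri< lt _ _ = ⊥-elim (ℕ.<-irrefl e (rank-< x y lt))
    ... | tri> _ _ gt = ⊥-elim (ℕ.<-irrefl (sym e) (rank-< y x gt))
    ... | tri≈ _ eq _ = index-injective x y (ℕ.+-cancelˡ-≡ (key x * (nV + nF)) _ _
          (trans e (cong (λ k → k * (nV + nF) + index y) (sym eq))))

    rank-incident : ∀ d → rank (inj₁ (vtx d)) < rank (inj₂ (fc d))
    rank-incident d = rank-< (inj₁ (vtx d)) (inj₂ (fc d)) (s≤s
        (ℕ.*-monoʳ-≤ 2 (maxOver-upper (λ x → fc x ≟ fc d) (r ∘ vtx) d refl)))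

    rank-separated : ∀ {v f} → Separates r v f → rank (inj₂ f) < rank (inj₁ v)
    rank-separated {v} {f} sep = rank-< (inj₂ f) (inj₁ v) (subst (_≤ 2 * r v) (ℕ.*-suc 2 (peak f))
        (ℕ.*-monoʳ-≤ 2 (maxOver-least (λ x → fc x ≟ f) (r ∘ vtx) (λ d → sep d) positive)))
      where
      positive : 0 < r v
      -- Every face has a dart, and `r v` exceeds the rank of its vertex.
      positive = let d , fd = OrbitLabelling.surj fc-orbits f in ℕ.≤-<-trans z≤n (sep d fd)

  module _ (r₁ r₂ : Fin nV → ℕ)
           (sep : ∀ v f → ¬ (∃[ d ] (vtx d ≡ v × fc d ≡ f)) → Separates r₁ v f ⊎ Separates r₂ v f) where

    private
      module L₁ = Extension r₁
      module L₂ = Extension r₂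

      -- A bound on all ranks in the first order, so that subtraction from `B` is never truncated
      -- and reverses that order.
      B : ℕ
      B = maxOver {P = λ _ → ⊤} (λ _ → yes tt) (L₁.rank ∘ inj₁) ⊔ maxOver {P = λ _ → ⊤} (λ _ → yes tt) (L₁.rank ∘ inj₂)

      ≤B : ∀ x → L₁.rank x ≤ B
      ≤B (inj₁ v) = ℕ.≤-trans (maxOver-upper (λ _ → yes tt) (L₁.rank ∘ inj₁) v tt) (ℕ.m≤m⊔n _ _)
      ≤B (inj₂ f) = ℕ.≤-trans (maxOver-upper (λ _ → yes tt) (L₁.rank ∘ inj₂) f tt) (ℕ.m≤n⊔m _ _)

      -- Both antichains in the order opposite to L₁, vertices below faces.
      L₃ : VF M → ℕ
      L₃ (inj₁ v) = B ∸ L₁.rank (inj₁ v)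
      L₃ (inj₂ f) = suc B + (B ∸ L₁.rank (inj₂ f))

      v<f : ∀ v f → L₃ (inj₁ v) < L₃ (inj₂ f)
      v<f v f = s≤s (ℕ.≤-trans (ℕ.m∸n≤m B (L₁.rank (inj₁ v))) (ℕ.m≤m+n B _))

      L₃-injective : ∀ x y → L₃ x ≡ L₃ y → x ≡ y
      L₃-injective (inj₁ v) (inj₁ w) e = L₁.rank-injective _ _ (ℕ.∸-cancelˡ-≡ (≤B (inj₁ v)) (≤B (inj₁ w)) e)
      L₃-injective (inj₁ v) (inj₂ f) e = ⊥-elim (ℕ.<-irrefl e (v<f v f))
      L₃-injective (inj₂ f) (inj₁ v) e = ⊥-elim (ℕ.<-irrefl (sym e) (v<f v f))
      L₃-injective (inj₂ f) (inj₂ g) e = L₁.rank-injective _ _ (ℕ.∸-cancelˡ-≡ (≤B (inj₂ f)) (≤B (inj₂ g))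
          (ℕ.+-cancelˡ-≡ (suc B) _ _ e))

      L : Fin 3 → VF M → ℕ
      L zero             = L₁.rank
      L (suc zero)       = L₂.rank
      L (suc (suc zero)) = L₃

      _⊑_ : VF M → VF M → Set
      x ⊑ y = ∀ i → L i x ≤ L i y

      sound : ∀ x y → _≤VF_ M x y → x ⊑ y
      sound (inj₁ v) (inj₁ .v) refl i = ℕ.≤-refl
      sound (inj₂ f) (inj₂ .f) refl i = ℕ.≤-refl
      sound (inj₁ v) (inj₂ f) (d , refl , refl) zero             = ℕ.<⇒≤ (L₁.rank-incident d)
      sound (inj₁ v) (inj₂ f) (d , refl , refl) (suc zero)       = ℕ.<⇒≤ (L₂.rank-incident d)
      sound (inj₁ v) (inj₂ f) _                 (suc (suc zero)) = ℕ.<⇒≤ (v<f v f)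

      complete : ∀ x y → x ⊑ y → _≤VF_ M x y
      complete (inj₁ v) (inj₁ w) le = inj₁-injective (L₁.rank-injective _ _
        (ℕ.≤-antisym (le zero) (ℕ.∸-cancelʳ-≤ (≤B (inj₁ w)) (le (suc (suc zero))))))
      complete (inj₂ f) (inj₂ g) le = inj₂-injective (L₁.rank-injective _ _
        (ℕ.≤-antisym (le zero) (ℕ.∸-cancelʳ-≤ (≤B (inj₂ g)) (ℕ.+-cancelˡ-≤ (suc B) _ _ (le (suc (suc zero)))))))
      complete (inj₂ f) (inj₁ v) le = ℕ.<⇒≱ (v<f v f) (le (suc (suc zero)))
      -- A vertex off `f` lies above `f` in one of the first two orders by `sep`, so being below in
      -- all three forces incidence.
      complete (inj₁ v) (inj₂ f) le = decidable-stable (any? (λ d → (vtx d ≟ v) ×-dec (fc d ≟ f))) λ ¬inc →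
        [ (λ s → ℕ.<⇒≱ (L₁.rank-separated s) (le zero)) , (λ s → ℕ.<⇒≱ (L₂.rank-separated s) (le (suc zero))) ]′
            (sep v f ¬inc)

    realizer : Realizer M 3
    realizer = L , injective , λ x y → sound x y , complete x y
      where
      injective : (i : Fin 3) → Inj (L i)
      injective zero             = L₁.rank-injective _ _
      injective (suc zero)       = L₂.rank-injective _ _
      injective (suc (suc zero)) = L₃-injective _ _

theorem4p1 : (M : PlanarMap) → Simple M → TwoConnected M →
    WeaklyOuterplanar M → DualWeaklyOuterplanar M → DimVF≤ M 3
theorem4p1 M simple 2conn outerplanar dualOuterplanar =
  let r₁ , r₂ , sep = Strip.ranks M simple 2conn outerplanar dualOuterplanar
  in 3 , ℕ.≤-refl , realizer M r₁ r₂ sep
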